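{- Let $G=(V,E)$ be a finite simple graph. (i) The dimension of the vector space $\mathbb{VD}(Z_G)$ is the number of non-empty subsets $K\subseteq V$ inducing a clique of $G$ (single vertices are counted). (ii) The faces $\triangle_K=\operatorname{conv}\{\mathbf{e}_u : u\in K\}$ of the standard simplex $\triangle_V$, for all non-empty $K\subseteq V$ inducing a clique of $G$, form a linear basis of $\mathbb{VD}(Z_G)$. (iii) For each $S\subseteq V$ with $|S|\ge 2$ not inducing a clique of $G$, choose one pair $\{u_S,v_S\}\in\binom{S}{2}\smallsetminus E$. Then $\mathbb{VD}(Z_G)$ is the set of virtual polytopes $D_h$ for all $h\in\mathbb{R}^{2^V}$ satisfying the equations $$h_{\varnothing}=-h_V,$$ $$h_{S\smallsetminus\{u_S\}}+h_{S\smallsetminus\{v_S\}}=h_S+h_{S\smallsetminus\{u_S,v_S\}}\quad\text{for each } S\subseteq V \text{ with } |S|\ge 2 \text{ not inducing a clique of } G,$$ and these equations are linearly independent.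
   Context: $G=(V,E)$ is a finite simple graph, so $E\subseteq\binom{V}{2}$, where $\binom{X}{2}$ denotes the set of two-element subsets of $X$. A subset $S\subseteq V$ induces a clique if all pairs of distinct elements of $S$ are edges. $(\mathbf{e}_v)_{v\in V}$ is the canonical basis of $\mathbb{R}^V$, and $2^V$ is the set of all subsets of $V$. The graphical zonotope is the Minkowski sum $Z_G=\sum_{\{u,v\}\in E}[\mathbf{e}_u,\mathbf{e}_v]\subset\mathbb{R}^V$. A (nonempty) polytope $P\subset\mathbb{R}^V$ is a weak Minkowski summand, or deformation, of a polytope $R\subset\mathbb{R}^V$ if there are $\lambda\ge 0$ and a polytope $Q$ with $P+Q=\lambda R$. The deformation cone $\mathbb{DC}(R)$ is the set of all deformations of $R$. Virtual polytopes: the real vector space of virtual polytopes in $\mathbb{R}^V$ consists of formal differences $P-Q$ of polytopes modulo $(P_1-Q_1)=(P_2-Q_2)$ whenever $P_1+P_2'=P_2+P_1'$ with $P_i'=Q_i$ (i.e. $P_1+Q_2=P_2+Q_1$), with addition induced by Minkowski addition and scalar multiplication $\lambda(P-Q)=\lambda P-\lambda Q$ for $\lambda\ge 0$ and $\lambda(P-Q)=(-\lambda)Q-(-\lambda)P$ for $\lambda<0$. A polytope $P$ is identified with $P-\{0\}$. The space of virtual deformations $\mathbb{VD}(Z_G)$ is the linear span of $\mathbb{DC}(Z_G)$ in this vector space. For $h\in\mathbb{R}^{2^V}$, the polyhedron $D_h=\{x\in\mathbb{R}^V : \sum_{v\in S}x_v-\sum_{v\notin S}x_v\le h_S \text{ for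 all } S\subseteq V\}$. Every deformation $P$ of $Z_G$ is $P=D_{h^P}$ with $h^P_S=\max_{x\in P}\big(\sum_{v\in S}x_v-\sum_{v\notin S}x_v\big)$. For virtual deformations the notation is extended as follows: for $P,Q\in\mathbb{DC}(Z_G)$, the virtual polytope $P-Q$ is denoted $D_{h}$ with $h=h^P-h^Q$; the vector $h$ determines the equivalence class of $P-Q$. -}

module Defs where

open import Level using (0ℓ) renaming (suc to lsuc)
open import Algebra.Bundles using (CommutativeRing)
open import Algebra.Module.Bundles.Raw using (RawLeftModule)
import Algebra.Definitions.RawMonoid as RawMonoidDefs
import Algebra.Properties.Semiring.Sum as SemiringSum
open import Data.Bool.Base using (if_then_else_)
open import Data.Fin.Base using (Fin; zero; suc; remQuot; combine; _↑ˡ_; _↑ʳ_) renaming (_<_ to _<ᶠ_)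
import Data.Fin.Properties as Fin
open import Data.Fin.Subset using (Subset; Nonempty; ∁; ∣_∣; ⊤; ⊥; _-_) renaming (_∈_ to _∈ˢ_)
open import Data.Fin.Subset.Properties using (_∈?_)
open import Data.List.Base using (List; []; _∷_; allFin; cartesianProduct; cartesianProductWith; filter; foldr; map)
open import Data.List.Membership.Propositional using (_∈_)
open import Data.List.Membership.Propositional.Properties
  using (∈-allFin; ∈-cartesianProductWith⁺; ∈-cartesianProductWith⁻; ∈-filter⁺; ∈-map⁺; ∈-map⁻)
open import Data.List.Relation.Unary.Any using (here; there)
open import Data.Maybe.Base using (Maybe; just; nothing)
open import Data.Nat.Base using (ℕ; zero; suc) renaming (_≤_ to _≤ᴺ_; _*_ to _*ᴺ_; _+_ to _+ᴺ_)
open import Data.Product using (Σ; ∃; ∃₂; _×_; _,_; proj₁; proj₂; uncurry)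
open import Data.Vec.Base using (lookup)
open import Data.Vec.Functional using (Vector)
open import Function.Base using (_∘_)
open import Function.Definitions using (Injective)
open import Relation.Binary.Core using (Rel)
open import Relation.Binary.Definitions using (Decidable; Irreflexive; Symmetric)
open import Relation.Binary.PropositionalEquality.Core as ≡ using (_≡_; _≢_)
open import Relation.Binary.Structures using (IsDecTotalOrder)
open import Relation.Nullary using (¬_; yes; no; does)
open import Relation.Nullary.Recomputable using (¬-recompute)
open import Relation.Nullary.Decidable using (_×-dec_)
open import Relation.Unary using (Pred; Satisfiable; _≐_)

------------------------------------------------------------------------
-- Real numbers

-- The library has no real numbers. They are axiomatised classically, as a
-- Dedekind-complete ordered field, which determines them up to a unique
-- isomorphism. Equality is the setoid equality of the ring, and the order
-- is decidable.

record RealField : Set₁ where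
  infix 4 _≤_
  field
    commutativeRing : CommutativeRing 0ℓ 0ℓ

  open CommutativeRing commutativeRing public

  field
    _≤_             : Rel Carrier 0ℓ
    isDecTotalOrder : IsDecTotalOrder _≈_ _≤_
    0≉1             : ¬ (0# ≈ 1#)
    inverse         : ∀ x → ¬ (x ≈ 0#) → ∃ λ y → x * y ≈ 1#
    +-monoʳ-≤       : ∀ z {x y} → x ≤ y → z + x ≤ z + y
    *-nonNeg        : ∀ {x y} → 0# ≤ x → 0# ≤ y → 0# ≤ x * y
    complete        : (A : Pred Carrier 0ℓ) → Satisfiable A →
                      (∃ λ b → ∀ x → A x → x ≤ b) →
                      ∃ λ s → (∀ x → A x → x ≤ s) ×
                              (∀ b → (∀ x → A x → x ≤ b) → s ≤ b)

  open IsDecTotalOrder isDecTotalOrder public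
    using (_≤?_; _≟_)
    renaming (refl to ≤-refl; trans to ≤-trans; antisym to ≤-antisym;
              total to ≤-total)

------------------------------------------------------------------------
-- Graphs on the vertex set V = Fin n

record SimpleGraph (n : ℕ) : Set₁ where
  field
    Adj    : Rel (Fin n) 0ℓ
    sym    : Symmetric Adj
    irrefl : Irreflexive _≡_ Adj
    adj?   : Decidable Adj

module _ {n : ℕ} (G : SimpleGraph n) where
  open SimpleGraph G

  InducesClique : Pred (Subset n) 0ℓ
  InducesClique S = ∀ {u v} → u ∈ˢ S → v ∈ˢ S → u ≢ v → Adj u v

  -- The irrelevant fields make equality in this type, and in NonClique
  -- below, equality of the underlying subsets.
  record NonemptyClique : Set where
    field
      set       : Subset n
      .nonempty : Nonempty set
      .clique   : InducesClique set

  record NonClique : Set where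
    field
      set        : Subset n
      .size≥2    : 2 ≤ᴺ ∣ set ∣
      .notClique : ¬ InducesClique set

  record NonEdgeIn (S : Subset n) : Set where
    field
      u v      : Fin n
      u∈S      : u ∈ˢ S
      v∈S      : v ∈ˢ S
      distinct : u ≢ v
      notAdj   : ¬ Adj u v

  -- Each edge {u , v} is listed once, with u < v.
  edges : List (Fin n × Fin n)
  edges = filter (λ (u , v) → (u Fin.<? v) ×-dec adj? u v)
                 (cartesianProduct (allFin n) (allFin n))

------------------------------------------------------------------------

module Reals (𝓡 : RealField) where
  open RealField 𝓡 hiding (_-_; zero) renaming (Carrier to ℝ)
  open CommutativeRing commutativeRing using () renaming (_-_ to _-ᴿ_)
  open SemiringSum semiring
    using (sum; sum-cong-≋; ∑-distrib-+; *-distribˡ-sum; *-distribʳ-sum)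

  ----------------------------------------------------------------------
  -- Linear algebra

  module LinearAlgebra {m ℓ} (M : RawLeftModule ℝ m ℓ) where
    open RawLeftModule M
    open RawMonoidDefs +ᴹ-rawMonoid using () renaming (sum to sumᴹ)

    linearCombination : ∀ {k} → Vector ℝ k → Vector Carrierᴹ k → Carrierᴹ
    linearCombination c x = sumᴹ (λ i → c i *ₗ x i)

    Span : ∀ {a} → Pred Carrierᴹ a → Pred Carrierᴹ _
    Span A x = ∃ λ k → Σ (Vector ℝ k) λ c → Σ (Vector Carrierᴹ k) λ a →
               (∀ i → A (a i)) × x ≈ᴹ linearCombination c a

    LinearlyIndependent : {I : Set} → (I → Carrierᴹ) → Set _
    LinearlyIndependent {I} b =
      ∀ k (φ : Fin k → I) → Injective _≡_ _≡_ φ → (c : Vector ℝ k) →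
      linearCombination c (b ∘ φ) ≈ᴹ 0ᴹ → ∀ i → c i ≈ 0#

    IsBasis : ∀ {a} → Pred Carrierᴹ a → {I : Set} → (I → Carrierᴹ) → Set _
    IsBasis U b =
      (∀ i → U (b i)) × LinearlyIndependent b ×
      (∀ x → U x → Span (λ y → ∃ λ i → y ≡ b i) x)

    HasDimension : ∀ {a} → Pred Carrierᴹ a → ℕ → Set _
    HasDimension U d = Σ (Fin d → Carrierᴹ) (IsBasis U)

  -- The real-valued functions on X, with pointwise operations.
  functionSpace : Set → RawLeftModule ℝ 0ℓ 0ℓ
  functionSpace X = record
    { Carrierᴹ = X → ℝ
    ; _≈ᴹ_     = λ f g → ∀ x → f x ≈ g x
    ; _+ᴹ_     = λ f g x → f x + g x
    ; _*ₗ_     = λ r f x → r * f x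
    ; 0ᴹ       = λ _ → 0#
    ; -ᴹ_      = λ f x → - f x
    }

  module _ {n : ℕ} where

    --------------------------------------------------------------------
    -- Points and polytopes of ℝ^V

    Point : Set
    Point = Vector ℝ n

    open RawLeftModule (functionSpace (Fin n)) public
      using () renaming (_≈ᴹ_ to _≈ₚ_; _+ᴹ_ to _+ₚ_; _*ₗ_ to _*ₚ_; 0ᴹ to 0ₚ)

    𝐞 : Fin n → Point
    𝐞 u v = if does (u Fin.≟ v) then 1# else 0#

    conv : Pred Point 0ℓ → Pred Point 0ℓ
    conv A x = ∃ λ k → Σ (Vector ℝ k) λ c → Σ (Vector Point k) λ a →
               (∀ i → 0# ≤ c i) × (∀ i → A (a i)) × sum c ≈ 1# ×
               (∀ v → x v ≈ sum (λ i → c i * a i v))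

    _+ₘ_ : Pred Point 0ℓ → Pred Point 0ℓ → Pred Point 0ℓ
    (A +ₘ B) x = ∃₂ λ a b → A a × B b × x ≈ₚ a +ₚ b

    _·ₘ_ : ℝ → Pred Point 0ℓ → Pred Point 0ℓ
    (r ·ₘ A) x = ∃ λ a → A a × x ≈ₚ r *ₚ a

    -- A polytope is presented by a finite nonempty list of points of which
    -- it is the convex hull; two presentations are identified when they
    -- have the same hull.
    record Polytope : Set where
      field
        points   : List Point
        nonempty : points ≢ []

    open Polytope

    ⟦_⟧ : Polytope → Pred Point 0ℓ
    ⟦ P ⟧ = conv (_∈ points P)

    infix 4 _≈ᴾ_
    _≈ᴾ_ : Rel Polytope 0ℓ
    P ≈ᴾ Q = ⟦ P ⟧ ≐ ⟦ Q ⟧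

    private
      ∈⇒≢[] : ∀ {A : Set} {x : A} {xs} → x ∈ xs → xs ≢ []
      ∈⇒≢[] (here _)  ()
      ∈⇒≢[] (there _) ()

      product≢[] : ∀ {A : Set} (f : A → A → A) {xs ys : List A} → xs ≢ [] → ys ≢ [] →
                   cartesianProductWith f xs ys ≢ []
      product≢[] f {[]}             xs≢ ys≢ _ = xs≢ ≡.refl
      product≢[] f {x ∷ xs} {[]}     xs≢ ys≢ _ = ys≢ ≡.refl
      product≢[] f {x ∷ xs} {y ∷ ys} xs≢ ys≢ ()

      map≢[] : ∀ {A B : Set} (f : A → B) {xs} → xs ≢ [] → map f xs ≢ []
      map≢[] f {[]}     xs≢ _ = xs≢ ≡.refl
      map≢[] f {x ∷ xs} xs≢ ()

    -- Minkowski sum; ⟦⊕⟧ below shows that it is the sum of point sets.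
    infixl 6 _⊕_
    _⊕_ : Polytope → Polytope → Polytope
    P ⊕ Q = record
      { points   = cartesianProductWith _+ₚ_ (points P) (points Q)
      ; nonempty = product≢[] _+ₚ_ (nonempty P) (nonempty Q)
      }

    infixr 7 _⊙_
    _⊙_ : ℝ → Polytope → Polytope
    r ⊙ P = record
      { points   = map (r *ₚ_) (points P)
      ; nonempty = map≢[] (r *ₚ_) (nonempty P)
      }

    𝟎 : Polytope
    𝟎 = record { points = 0ₚ ∷ [] ; nonempty = λ () }

    segment : Point → Point → Polytope
    segment a b = record { points = a ∷ b ∷ [] ; nonempty = λ () }

    △ : (K : Subset n) → .(Nonempty K) → Polytope
    △ K ne = record
      { points   = map 𝐞 (filter (_∈? K) (allFin n))
      ; nonempty = ¬-recompute
          (map≢[] 𝐞 (∈⇒≢[] (∈-filter⁺ (_∈? K) (∈-allFin (proj₁ ne)) (proj₂ ne))))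
      }

    cliqueFace : (G : SimpleGraph n) → NonemptyClique G → Polytope
    cliqueFace G record { set = K ; nonempty = ne } = △ K ne

    zonotope : SimpleGraph n → Polytope
    zonotope G = foldr (λ (u , v) Z → segment (𝐞 u) (𝐞 v) ⊕ Z) 𝟎 (edges G)

    --------------------------------------------------------------------
    -- Deformations

    DC : Polytope → Pred Polytope 0ℓ
    DC R P = ∃₂ λ r Q → 0# ≤ r × P ⊕ Q ≈ᴾ r ⊙ R

    --------------------------------------------------------------------
    -- Virtual polytopes

    record VirtualPolytope : Set where
      constructor _⊖_
      field
        plus minus : Polytope

    infix 4 _≈ⱽ_
    _≈ⱽ_ : Rel VirtualPolytope 0ℓ
    (P₁ ⊖ Q₁) ≈ⱽ (P₂ ⊖ Q₂) = P₁ ⊕ Q₂ ≈ᴾ P₂ ⊕ Q₁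

    _·ⱽ_ : ℝ → VirtualPolytope → VirtualPolytope
    r ·ⱽ (P ⊖ Q) with 0# ≤? r
    ... | yes _ = (r ⊙ P) ⊖ (r ⊙ Q)
    ... | no  _ = ((- r) ⊙ Q) ⊖ ((- r) ⊙ P)

    -- A raw bundle: it fixes the operations and the equality of formal
    -- differences, which is all that spans, bases and dimension refer to.
    virtualPolytopes : RawLeftModule ℝ 0ℓ 0ℓ
    virtualPolytopes = record
      { Carrierᴹ = VirtualPolytope
      ; _≈ᴹ_     = _≈ⱽ_
      ; _+ᴹ_     = λ (P₁ ⊖ Q₁) (P₂ ⊖ Q₂) → (P₁ ⊕ P₂) ⊖ (Q₁ ⊕ Q₂)
      ; _*ₗ_     = _·ⱽ_
      ; 0ᴹ       = 𝟎 ⊖ 𝟎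
      ; -ᴹ_      = λ (P ⊖ Q) → Q ⊖ P
      }

    ι : Polytope → VirtualPolytope
    ι P = P ⊖ 𝟎

    VD : Polytope → Pred VirtualPolytope 0ℓ
    VD R = LinearAlgebra.Span virtualPolytopes (λ x → ∃ λ P → DC R P × x ≈ⱽ ι P)

    --------------------------------------------------------------------
    -- The virtual polytopes D_h

    sumOver : Subset n → Point → ℝ
    sumOver S x = sum (λ v → if lookup S v then x v else 0#)

    direction : Subset n → Point → ℝ
    direction S x = sumOver S x -ᴿ sumOver (∁ S) x

    IsSupportVector : Polytope → Pred (Subset n → ℝ) 0ℓ
    IsSupportVector P h =
      ∀ S → (∀ x → ⟦ P ⟧ x → direction S x ≤ h S) ×
            (∃ λ x → ⟦ P ⟧ x × direction S x ≈ h S)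

    -- IsD R h x: the virtual polytope x is D_h, i.e. x = P − Q with
    -- P , Q ∈ DC R and h = h^P − h^Q.
    IsD : Polytope → (Subset n → ℝ) → Pred VirtualPolytope 0ℓ
    IsD R h x =
      ∃₂ λ P Q → ∃₂ λ hᴾ hᵠ →
      DC R P × DC R Q × IsSupportVector P hᴾ × IsSupportVector Q hᵠ ×
      (∀ S → h S ≈ hᴾ S -ᴿ hᵠ S) × x ≈ⱽ (P ⊖ Q)

    --------------------------------------------------------------------
    -- The system of equations: 'nothing' indexes the equation
    -- h ∅ = - h V, and 'just S' the equation of a non-clique S.

    module Equations (G : SimpleGraph n)
                     (choice : (S : NonClique G) → NonEdgeIn G (NonClique.set S)) where

      Index : Set
      Index = Maybe (NonClique G)

      lhs rhs : Index → (Subset n → ℝ) → ℝ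
      lhs nothing  h = h ⊥
      lhs (just S) h = h (NonClique.set S - u) + h (NonClique.set S - v)
        where
        open NonEdgeIn (choice S) using (u; v)
      rhs nothing  h = - h ⊤
      rhs (just S) h = h (NonClique.set S) + h (NonClique.set S - u - v)
        where
        open NonEdgeIn (choice S) using (u; v)

      Satisfies : Pred (Subset n → ℝ) 0ℓ
      Satisfies h = ∀ i → lhs i h ≈ rhs i h

      -- Linear independence of the equations is that of these linear forms.
      form : Index → (Subset n → ℝ) → ℝ
      form i h = lhs i h -ᴿ rhs i h

      EquationsIndependent : Set
      EquationsIndependent =
        LinearAlgebra.LinearlyIndependent (functionSpace (Subset n → ℝ)) form

    --------------------------------------------------------------------
    -- Minkowski sums and dilations of polytopes are those of their point
    -- sets

    private
      sum-cong : ∀ {k} {f g : Vector ℝ k} → (∀ i → f i ≈ g i) → sum f ≈ sum g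
      sum-cong = sum-cong-≋

      sum-++ : ∀ k l (f : Fin (k +ᴺ l) → ℝ) →
               sum f ≈ sum (λ i → f (i ↑ˡ l)) + sum (λ j → f (k ↑ʳ j))
      sum-++ zero    l f = sym (+-identityˡ _)
      sum-++ (suc k) l f = trans (+-congˡ (sum-++ k l (f ∘ suc))) (sym (+-assoc (f zero) _ _))

      sum-combine : ∀ k l (f : Fin (k *ᴺ l) → ℝ) →
                    sum f ≈ sum (λ (i : Fin k) → sum (λ (j : Fin l) → f (combine i j)))
      sum-combine zero    l f = refl
      sum-combine (suc k) l f =
        trans (sum-++ l (k *ᴺ l) f) (+-congˡ (sum-combine k l (λ i → f (l ↑ʳ i))))

      sum-remQuot : ∀ k l (f : Fin k × Fin l → ℝ) →
                    sum (λ i → f (remQuot {k} l i)) ≈ sum (λ i → sum (λ j → f (i , j)))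
      sum-remQuot k l f = trans (sum-combine k l (f ∘ remQuot {k} l))
        (sum-cong λ (i : Fin k) → sum-cong {f = λ (j : Fin l) → f (remQuot {k} l (combine i j))} {λ j → f (i , j)}
           λ j → reflexive (≡.cong f (Fin.remQuot-combine i j)))

    ⟦⊕⟧ : ∀ P Q → ⟦ P ⊕ Q ⟧ ≐ ⟦ P ⟧ +ₘ ⟦ Q ⟧
    ⟦⊕⟧ P Q = to , from
      where
      to : ∀ {x} → ⟦ P ⊕ Q ⟧ x → (⟦ P ⟧ +ₘ ⟦ Q ⟧) x
      to {x} (k , c , p , c≥0 , p∈ , ∑c≈1 , x≈) =
        (λ v → sum (λ i → c i * a i v)) , (λ v → sum (λ i → c i * b i v)) ,
        (k , c , a , c≥0 , (λ i → proj₁ (proj₂ (proj₂ (split i)))) , ∑c≈1 , λ v → refl) ,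
        (k , c , b , c≥0 , (λ i → proj₁ (proj₂ (proj₂ (proj₂ (split i))))) , ∑c≈1 , λ v → refl) ,
        λ v → trans (x≈ v) (trans
          (sum-cong λ i → trans (*-congˡ (reflexive (≡.cong (λ q → q v)
                                    (proj₂ (proj₂ (proj₂ (proj₂ (split i))))))))
                                  (distribˡ _ _ _))
          (∑-distrib-+ (λ i → c i * a i v) (λ i → c i * b i v)))
        where
        split = λ i → ∈-cartesianProductWith⁻ _+ₚ_ (points P) (points Q) (p∈ i)
        a b : Vector Point k
        a i = proj₁ (split i)
        b i = proj₁ (proj₂ (split i))

      from : ∀ {x} → (⟦ P ⟧ +ₘ ⟦ Q ⟧) x → ⟦ P ⊕ Q ⟧ x
      from {x} (p , q , (k , c , a , c≥0 , a∈ , ∑c≈1 , p≈) , (l , d , b , d≥0 , b∈ , ∑d≈1 , q≈) , x≈) =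
        k *ᴺ l ,
        (λ i → weight (remQuot {k} l i)) , (λ i → vertex (remQuot {k} l i)) ,
        (λ i → *-nonNeg (c≥0 _) (d≥0 _)) ,
        (λ i → ∈-cartesianProductWith⁺ _+ₚ_ (a∈ _) (b∈ _)) ,
        trans (sum-remQuot k l weight)
          (trans (sum-cong λ i → trans (sym (*-distribˡ-sum (c i) d))
                                         (trans (*-congˡ ∑d≈1) (*-identityʳ _)))
                 ∑c≈1) ,
        λ v → trans (x≈ v) (sym (trans (sum-remQuot k l (λ ij → weight ij * vertex ij v))
          (trans (sum-cong (inner v))
          (trans (∑-distrib-+ (λ i → c i * a i v) (λ i → c i * q v))
          (+-cong (sym (p≈ v))
                  (trans (sym (*-distribʳ-sum (q v) c))
                         (trans (*-congʳ ∑c≈1) (*-identityˡ _))))))))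
        where
        weight : Fin k × Fin l → ℝ
        weight (i , j) = c i * d j
        vertex : Fin k × Fin l → Point
        vertex (i , j) = a i +ₚ b j
        inner : ∀ v i → sum (λ j → weight (i , j) * vertex (i , j) v) ≈ c i * a i v + c i * q v
        inner v i =
          trans (sum-cong λ j → trans (*-assoc (c i) (d j) _) (*-congˡ (distribˡ (d j) (a i v) (b j v))))
          (trans (sym (*-distribˡ-sum (c i) (λ j → d j * a i v + d j * b j v)))
          (trans (*-congˡ (trans (∑-distrib-+ (λ j → d j * a i v) (λ j → d j * b j v))
                   (+-cong (trans (sym (*-distribʳ-sum (a i v) d))
                                  (trans (*-congʳ ∑d≈1) (*-identityˡ _)))
                           (sym (q≈ v)))))
                 (distribˡ _ _ _)))

    ⟦⊙⟧ : ∀ r P → ⟦ r ⊙ P ⟧ ≐ r ·ₘ ⟦ P ⟧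
    ⟦⊙⟧ r P = to , from
      where
      swap : ∀ x y z → x * (y * z) ≈ y * (x * z)
      swap x y z = trans (sym (*-assoc _ _ _)) (trans (*-congʳ (*-comm _ _)) (*-assoc _ _ _))

      pull : ∀ {k} (c y : Vector ℝ k) → sum (λ i → c i * (r * y i)) ≈ r * sum (λ i → c i * y i)
      pull c y = trans (sum-cong λ i → swap (c i) r (y i)) (sym (*-distribˡ-sum r (λ i → c i * y i)))

      to : ∀ {x} → ⟦ r ⊙ P ⟧ x → (r ·ₘ ⟦ P ⟧) x
      to {x} (k , c , p , c≥0 , p∈ , ∑c≈1 , x≈) =
        (λ v → sum (λ i → c i * a i v)) ,
        (k , c , a , c≥0 , (λ i → proj₁ (proj₂ (preimage i))) , ∑c≈1 , λ v → refl) ,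
        λ v → trans (x≈ v)
          (trans (sum-cong λ i → *-congˡ (reflexive (≡.cong (λ q → q v) (proj₂ (proj₂ (preimage i))))))
                 (pull c (λ i → a i v)))
        where
        preimage = λ i → ∈-map⁻ (r *ₚ_) (p∈ i)
        a : Vector Point k
        a i = proj₁ (preimage i)

      from : ∀ {x} → (r ·ₘ ⟦ P ⟧) x → ⟦ r ⊙ P ⟧ x
      from (p , (k , c , a , c≥0 , a∈ , ∑c≈1 , p≈) , x≈) =
        k , c , (λ i → r *ₚ a i) , c≥0 , (λ i → ∈-map⁺ (r *ₚ_) (a∈ i)) , ∑c≈1 ,
        λ v → trans (x≈ v) (trans (*-congˡ (p≈ v)) (sym (pull c (λ i → a i v))))

module Submission where

-- By Farkas' lemma a polytope is determined by its support function, so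
-- P - Q ↦ h P - h Q embeds the virtual polytopes into the functions on ℝ^V.
-- The summands P of multiples of Z have support functions that are additive
-- on pairs of vectors ordering the ends of every edge alike. Such a function
-- f is determined by the values f (- 1_S), since every vector is a constant
-- plus a nonnegative combination of vectors - 1_S along a chain of sets S.
-- These values are modular along the non-edges, hence combinations of the
-- functions S ↦ [K ⊆ S] for cliques K; and - [K ⊆ S] is the value at - 1_S of
-- the support function of △ K. Conversely △ K is a summand of Z for a clique
-- K, and the same interpolation applied to h itself writes a solution h of
-- the equations as a combination of the reflected faces - △ K.

-- The sets S enter through two families of vectors, which call for opposite signs of the faces. At
-- - 1_S the maximum over △ K is - 1 if K lies in S and 0 otherwise, so containment, the indicator
-- that modularity controls, is what a face detects. At the directions 1_S - 1_(V - S) of the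
-- equations, △ K would detect whether K meets S; its reflection has the value 1 - 2 [K ⊆ S] there
-- and brings containment back. The price is a proof that - △ K is again a deformation. One equation
-- per non-clique is enough, although the fan imposes one for every non-edge inside it: the chosen
-- equation gives the value at S from smaller sets, down to cliques and ∅, while the clique
-- indicators satisfy all of them.

open import Defs
import Algebra.Construct.NaturalChoice.Max as Max
import Algebra.Properties.CommutativeSemigroup as CommutativeSemigroupProperties
import Algebra.Properties.Ring as RingProperties
import Algebra.Properties.Semiring.Mult.TCOptimised as SemiringMult
import Algebra.Properties.Semiring.Sum as SemiringSum
import Algebra.Solver.Ring as RingSolver
open import Algebra.Bundles using (RawRing)
open import Algebra.Module.Bundles.Raw using (RawLeftModule)
open import Algebra.Solver.Ring.AlmostCommutativeRing
  using (fromCommutativeRing; _-Raw-AlmostCommutative⟶_)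
open import Data.Bool.Base using (Bool; true; false; if_then_else_; not)
import Data.Bool.Properties as Bool
open import Data.Empty using (⊥-elim-irr)
open import Data.Fin.Base using (Fin; zero; suc)
import Data.Fin.Properties as Fin
open import Data.Fin.Subset
  using (Subset; Nonempty; ∁; ∣_∣; _⊆_; inside; outside; ⊥; ⊤)
  renaming (_∈_ to _∈ˢ_; _∉_ to _∉ˢ_; _-_ to _∖_)
open import Data.Fin.Subset.Properties
  using (_∈?_; _⊆?_; nonempty?; Empty-unique; ∈⊤; ∉⊥; ⊆-max; ⊆-antisym; p─⊥≡p; p─q⊆p;
         x∈p∧x≢y⇒x∈p-y; x∈p⇒∣p-x∣<∣p∣; p⊂q⇒∣p∣<∣q∣; ∣p∣≤n)
open import Data.Irrelevant using ([_])
open import Data.List.Base as List using (List; []; _∷_; allFin; concatMap; filter; foldr)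
open import Data.List.Membership.Propositional using (_∈_; find; lose)
open import Data.List.Membership.Propositional.Properties
  using (∈-allFin; ∈-cartesianProduct⁺; ∈-cartesianProductWith⁺; ∈-cartesianProductWith⁻;
         ∈-filter⁺; ∈-filter⁻; ∈-lookup; ∈-map⁺; ∈-map⁻)
open import Data.List.Relation.Unary.Any as Any using (here; there)
open import Data.List.Relation.Unary.Any.Properties using (concatMap⁺; concatMap⁻)
open import Data.Maybe.Base using (Maybe; just; nothing)
open import Data.Nat.Base as ℕ using (ℕ; zero; suc; z≤n; s≤s; _∸_) renaming (_≤_ to _≤ᴺ_; _<_ to _<ᴺ_)
import Data.Nat.Properties as ℕ
open import Data.Product using (Σ; ∃; ∃₂; _×_; _,_; proj₁; proj₂)
open import Data.Refinement.Base using (Refinement; _,_)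
open import Data.Sum.Base as Sum using (_⊎_; inj₁; inj₂; [_,_]′)
open import Data.Sum.Function.Propositional using (_⊎-cong_)
open import Data.Vec.Base using ([]; _∷_; lookup)
open import Data.Vec.Functional as Vector using (Vector)
open import Data.Vec.Properties using ([]=⇒lookup; lookup⇒[]=; lookup-map; ≡-dec)
open import Function.Base using (_∘_)
open import Function.Bundles using (_↔_; _⇔_; mk↔ₛ′; mk⇔; Inverse)
open import Function.Construct.Composition using (_↔-∘_)
open import Function.Definitions using (Injective)
open import Level using (0ℓ)
open import Relation.Binary.Bundles using (TotalOrder)
open import Relation.Binary.Definitions using (tri<; tri≈; tri>)
open import Relation.Binary.PropositionalEquality.Core as ≡ using (_≡_; _≢_)
import Relation.Binary.Reasoning.Setoid as SetoidReasoning
open import Relation.Binary.Structures using (IsDecTotalOrder)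
open import Relation.Nullary using (¬_; Dec; yes; no; does; contradiction)
open import Relation.Nullary.Decidable using (dec-true; dec-false; _×-dec_; _⊎-dec_; ¬?; recompute)
open import Relation.Nullary.Negation using (contradiction-irr)
open import Relation.Unary using (Pred; Decidable)

-- Ordered field arithmetic, finite sums and Farkas' lemma.

module OrderedField (𝓡 : RealField) where
  open RealField 𝓡 public hiding (zero) renaming (Carrier to ℝ)
  open RingProperties ring public using (-‿distribˡ-*; -‿distribʳ-*; -‿involutive; -‿+-comm; -0#≈0#)
  open SemiringSum semiring public using (sum; sum-cong-≋; ∑-distrib-+; *-distribˡ-sum; *-distribʳ-sum; ∑-comm)

  -- The solver takes integer coefficients, presented as differences of
  -- naturals; with coefficients in the abstract field no cancellation
  -- would compute.
  private
    module Mult = SemiringMult semiring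
    open Mult using () renaming (_×_ to _×ᴺ_)
    open SetoidReasoning setoid
    open CommutativeSemigroupProperties +-commutativeSemigroup using (interchange)

    differences : RawRing 0ℓ 0ℓ
    differences = record
      { Carrier = ℕ × ℕ
      ; _≈_     = _≡_
      ; _+_     = λ (p , q) (p′ , q′) → p ℕ.+ p′ , q ℕ.+ q′
      ; _*_     = λ (p , q) (p′ , q′) → p ℕ.* p′ ℕ.+ q ℕ.* q′ , p ℕ.* q′ ℕ.+ q ℕ.* p′
      ; -_      = λ (p , q) → q , p
      ; 0#      = 0 , 0
      ; 1#      = 1 , 0
      }

    nat : ℕ → ℝ
    nat m = m ×ᴺ 1#

    ⟦_⟧ᵈ : ℕ × ℕ → ℝ
    ⟦ p , q ⟧ᵈ = nat p + - nat q

    -‿+-interchange : ∀ a b c d → (a + b) + - (c + d) ≈ (a + - c) + (b + - d)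
    -‿+-interchange a b c d = trans (+-congˡ (sym (-‿+-comm c d))) (interchange a b (- c) (- d))

    *-difference : ∀ a b c d → (a * c + b * d) + - (a * d + b * c) ≈ (a + - b) * (c + - d)
    *-difference a b c d = begin
      (a * c + b * d) + - (a * d + b * c)              ≈⟨ -‿+-interchange _ _ _ _ ⟩
      (a * c + - (a * d)) + (b * d + - (b * c))        ≈⟨ +-cong
        (trans (+-congˡ (-‿distribʳ-* a d)) (sym (distribˡ a c (- d))))
        (trans (+-comm _ _) (trans (+-cong (-‿distribˡ-* b c)
          (trans (sym (-‿involutive _)) (trans (-‿cong (-‿distribʳ-* b d)) (-‿distribˡ-* b (- d)))))
          (sym (distribˡ (- b) c (- d))))) ⟩
      a * (c + - d) + - b * (c + - d)                  ≈⟨ distribʳ _ _ _ ⟨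
      (a + - b) * (c + - d)                            ∎

    morphism : differences -Raw-AlmostCommutative⟶ fromCommutativeRing commutativeRing
    morphism = record
      { ⟦_⟧    = ⟦_⟧ᵈ
      ; +-homo = λ (p , q) (p′ , q′) → trans
          (+-cong (Mult.×-homo-+ 1# p p′) (-‿cong (Mult.×-homo-+ 1# q q′)))
          (-‿+-interchange _ _ _ _)
      ; *-homo = λ (p , q) (p′ , q′) → trans
          (+-cong (product p p′ q q′) (-‿cong (product p q′ q p′)))
          (*-difference _ _ _ _)
      ; -‿homo = λ (p , q) → trans (+-comm _ _)
          (trans (+-congˡ (sym (-‿involutive _))) (-‿+-comm (nat p) (- nat q)))
      ; 0-homo = trans (+-identityˡ _) -0#≈0#
      ; 1-homo = trans (+-congˡ -0#≈0#) (+-identityʳ _)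
      }
      where
      product : ∀ a b c d → nat (a ℕ.* b ℕ.+ c ℕ.* d) ≈ nat a * nat b + nat c * nat d
      product a b c d = trans (Mult.×-homo-+ 1# (a ℕ.* b) (c ℕ.* d))
                              (+-cong (Mult.×1-homo-* a b) (Mult.×1-homo-* c d))

    -- Pairs are never normalised, so equal differences such as (1 , 1) and (0 , 0) are recognised
    -- by cross-addition.
    _coeff≟_ : ∀ x y → Maybe (⟦ x ⟧ᵈ ≈ ⟦ y ⟧ᵈ)
    (p , q) coeff≟ (p′ , q′) with p ℕ.+ q′ ℕ.≟ p′ ℕ.+ q
    ... | no  _ = nothing
    ... | yes e = just (begin
      nat p + - nat q                                 ≈⟨ +-identityʳ _ ⟨
      (nat p + - nat q) + 0#                          ≈⟨ +-congˡ (-‿inverseʳ (nat q′)) ⟨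
      (nat p + - nat q) + (nat q′ + - nat q′)         ≈⟨ interchange _ _ _ _ ⟩
      (nat p + nat q′) + (- nat q + - nat q′)         ≈⟨ +-cong (trans (sym (Mult.×-homo-+ 1# p q′))
        (trans (reflexive (≡.cong nat e)) (Mult.×-homo-+ 1# p′ q))) (+-comm _ _) ⟩
      (nat p′ + nat q) + (- nat q′ + - nat q)         ≈⟨ interchange _ _ _ _ ⟩
      (nat p′ + - nat q′) + (nat q + - nat q)         ≈⟨ +-congˡ (-‿inverseʳ (nat q)) ⟩
      (nat p′ + - nat q′) + 0#                        ≈⟨ +-identityʳ _ ⟩
      nat p′ + - nat q′                               ∎)

  module Solver = RingSolver differences (fromCommutativeRing commutativeRing) morphism _coeff≟_
  open Solver public using (solve; _:=_; _:+_; _:*_; :-_; _:-_; con)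

  ≤-totalOrder : TotalOrder 0ℓ 0ℓ 0ℓ
  ≤-totalOrder = record { isTotalOrder = IsDecTotalOrder.isTotalOrder isDecTotalOrder }

  open TotalOrder ≤-totalOrder public
    using () renaming (reflexive to ≤-reflexive;
                       ≤-respˡ-≈ to ≤-respˡ-≈; ≤-respʳ-≈ to ≤-respʳ-≈)
  open Max ≤-totalOrder public
    using (_⊔_; ⊔-comm; x≤x⊔y; x≤y⊔x; x≤y⇒x⊔y≈y; ⊔-sel)

  ≤-resp₂ : ∀ {x x′ y y′} → x ≈ x′ → y ≈ y′ → x ≤ y → x′ ≤ y′
  ≤-resp₂ e f = ≤-respʳ-≈ f ∘ ≤-respˡ-≈ e

  +-mono-≤ : ∀ {w x y z} → w ≤ x → y ≤ z → w + y ≤ x + z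
  +-mono-≤ {w} {x} {y} {z} w≤x y≤z =
    ≤-trans (+-monoʳ-≤ w y≤z) (≤-resp₂ (+-comm z w) (+-comm z x) (+-monoʳ-≤ z w≤x))

  ≤⇒0≤- : ∀ {x y} → x ≤ y → 0# ≤ y - x
  ≤⇒0≤- {x} {y} p = ≤-resp₂ (-‿inverseˡ x) (+-comm (- x) y) (+-monoʳ-≤ (- x) p)

  0≤-⇒≤ : ∀ {x y} → 0# ≤ y - x → x ≤ y
  0≤-⇒≤ {x} {y} p = ≤-resp₂ (+-identityʳ x)
    (solve 2 (λ x y → x :+ (y :- x) := y) refl x y) (+-monoʳ-≤ x p)

  neg-mono-≤ : ∀ {x y} → x ≤ y → - y ≤ - x
  neg-mono-≤ {x} {y} p = 0≤-⇒≤ (≤-respʳ-≈ (solve 2 (λ x y → y :- x := :- x :- :- y) refl x y) (≤⇒0≤- p))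

  neg-nonNeg : ∀ {x} → 0# ≤ x → - x ≤ 0#
  neg-nonNeg p = ≤-respʳ-≈ -0#≈0# (neg-mono-≤ p)

  neg-nonPos : ∀ {x} → x ≤ 0# → 0# ≤ - x
  neg-nonPos p = ≤-respˡ-≈ -0#≈0# (neg-mono-≤ p)

  +-nonNeg : ∀ {x y} → 0# ≤ x → 0# ≤ y → 0# ≤ x + y
  +-nonNeg p q = ≤-respˡ-≈ (+-identityʳ 0#) (+-mono-≤ p q)

  *-monoʳ-≤ : ∀ {r x y} → 0# ≤ r → x ≤ y → r * x ≤ r * y
  *-monoʳ-≤ {r} {x} {y} r≥0 p = 0≤-⇒≤ (≤-respʳ-≈
    (solve 3 (λ r x y → r :* (y :- x) := r :* y :- r :* x) refl r x y) (*-nonNeg r≥0 (≤⇒0≤- p)))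

  *-nonNeg-nonPos : ∀ {x y} → 0# ≤ x → y ≤ 0# → x * y ≤ 0#
  *-nonNeg-nonPos {x} p q = ≤-respʳ-≈ (zeroʳ x) (*-monoʳ-≤ p q)

  x*x-nonNeg : ∀ x → 0# ≤ x * x
  x*x-nonNeg x with ≤-total 0# x
  ... | inj₁ p = *-nonNeg p p
  ... | inj₂ p = ≤-respʳ-≈ (solve 1 (λ x → :- x :* :- x := x :* x) refl x)
                           (*-nonNeg (neg-nonPos p) (neg-nonPos p))

  0≤1 : 0# ≤ 1#
  0≤1 = ≤-respʳ-≈ (*-identityʳ 1#) (x*x-nonNeg 1#)

  1≰0 : ¬ (1# ≤ 0#)
  1≰0 p = 0≉1 (≤-antisym 0≤1 p)

  ≰⇒≥ : ∀ {x y} → ¬ (x ≤ y) → y ≤ x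
  ≰⇒≥ {x} {y} x≰y with ≤-total x y
  ... | inj₁ p = contradiction p x≰y
  ... | inj₂ p = p

  positive-inverse : ∀ {x} → ¬ (x ≤ 0#) → ∃ λ y → 0# ≤ y × x * y ≈ 1#
  positive-inverse {x} x≰0 with inverse x (λ e → x≰0 (≤-reflexive e))
  ... | y , xy≈1 with ≤-total 0# y
  ...   | inj₁ p = y , p , xy≈1
  ...   | inj₂ p = contradiction (≤-respˡ-≈ xy≈1 (*-nonNeg-nonPos (≰⇒≥ x≰0) p)) 1≰0

  x*x≤0⇒x≈0 : ∀ {x} → x * x ≤ 0# → x ≈ 0#
  x*x≤0⇒x≈0 {x} p with x ≟ 0#
  ... | yes e = e
  ... | no  e with inverse x e
  ...   | y , xy≈1 = contradiction (≤-respˡ-≈ (trans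
            (solve 2 (λ x y → y :* y :* (x :* x) := (x :* y) :* (x :* y)) refl x y)
            (trans (*-cong xy≈1 xy≈1) (*-identityʳ 1#)))
            (*-nonNeg-nonPos (x*x-nonNeg y) p)) 1≰0

  half : ∃ λ y → y + y ≈ 1#
  half with positive-inverse {1# + 1#} (λ p → 1≰0 (≤-trans (≤-respˡ-≈ (+-identityʳ 1#) (+-monoʳ-≤ 1# 0≤1)) p))
  ... | y , _ , e = y , trans (solve 1 (λ y → y :+ y := (con (1 , 0) :+ con (1 , 0)) :* y) refl y)
     -- The constant `con (1 , 0)` denotes `1# + - 0#`, which has to be cleared before the inverse
     -- of 1 + 1 applies.
     (trans (*-congʳ (+-cong (trans (+-congˡ -0#≈0#) (+-identityʳ 1#)) (trans (+-congˡ -0#≈0#) (+-identityʳ 1#)))) e)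

  ∑-cong : ∀ {k} {f g : Vector ℝ k} → (∀ i → f i ≈ g i) → sum f ≈ sum g
  ∑-cong = sum-cong-≋

  ∑-zero : ∀ {k} {f : Vector ℝ k} → (∀ i → f i ≈ 0#) → sum f ≈ 0#
  ∑-zero {zero}  e = refl
  ∑-zero {suc k} e = trans (+-cong (e zero) (∑-zero (e ∘ suc))) (+-identityʳ 0#)

  ∑-nonNeg : ∀ {k} {f : Vector ℝ k} → (∀ i → 0# ≤ f i) → 0# ≤ sum f
  ∑-nonNeg {zero}  p = ≤-refl
  ∑-nonNeg {suc k} p = +-nonNeg (p zero) (∑-nonNeg (p ∘ suc))

  ∑-mono : ∀ {k} {f g : Vector ℝ k} → (∀ i → f i ≤ g i) → sum f ≤ sum g
  ∑-mono {zero}  p = ≤-refl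
  ∑-mono {suc k} p = +-mono-≤ (p zero) (∑-mono (p ∘ suc))

  term≤∑ : ∀ {k} {f : Vector ℝ k} → (∀ i → 0# ≤ f i) → ∀ i → f i ≤ sum f
  term≤∑ p zero    = ≤-respˡ-≈ (+-identityʳ _) (+-monoʳ-≤ _ (∑-nonNeg (p ∘ suc)))
  term≤∑ p (suc i) = ≤-respˡ-≈ (+-identityˡ _) (+-mono-≤ (p zero) (term≤∑ (p ∘ suc) i))

  ∑-single : ∀ {k} {f : Vector ℝ k} i → (∀ j → j ≢ i → f j ≈ 0#) → sum f ≈ f i
  ∑-single zero    e = trans (+-congˡ (∑-zero λ j → e (suc j) λ ())) (+-identityʳ _)
  ∑-single (suc i) e = trans (+-cong (e zero λ ()) (∑-single i λ j j≢i → e (suc j) (j≢i ∘ Fin.suc-injective)))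
                             (+-identityˡ _)

  ∑-neg : ∀ {k} (f : Vector ℝ k) → sum (λ i → - f i) ≈ - sum f
  ∑-neg {zero}  f = sym -0#≈0#
  ∑-neg {suc k} f = trans (+-congˡ (∑-neg (f ∘ suc))) (-‿+-comm _ _)

  ⟨_,_⟩ : ∀ {m} → Vector ℝ m → Vector ℝ m → ℝ
  ⟨ w , x ⟩ = sum (λ v → w v * x v)

  module _ {m : ℕ} where

    ⟨⟩-cong : {w w′ x x′ : Vector ℝ m} → (∀ v → w v ≈ w′ v) → (∀ v → x v ≈ x′ v) → ⟨ w , x ⟩ ≈ ⟨ w′ , x′ ⟩
    ⟨⟩-cong e f = ∑-cong λ v → *-cong (e v) (f v)

    ⟨⟩-comm : (w x : Vector ℝ m) → ⟨ w , x ⟩ ≈ ⟨ x , w ⟩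
    ⟨⟩-comm w x = ∑-cong λ v → *-comm (w v) (x v)

    ⟨⟩-+ʳ : (w x y : Vector ℝ m) → ⟨ w , (λ v → x v + y v) ⟩ ≈ ⟨ w , x ⟩ + ⟨ w , y ⟩
    ⟨⟩-+ʳ w x y = trans (∑-cong λ v → distribˡ (w v) (x v) (y v)) (∑-distrib-+ (λ v → w v * x v) (λ v → w v * y v))

    ⟨⟩-*ʳ : ∀ r (w x : Vector ℝ m) → ⟨ w , (λ v → r * x v) ⟩ ≈ r * ⟨ w , x ⟩
    ⟨⟩-*ʳ r w x = trans (∑-cong λ v → solve 3 (λ r w x → w :* (r :* x) := r :* (w :* x)) refl r (w v) (x v))
                        (sym (*-distribˡ-sum r (λ v → w v * x v)))

    ⟨⟩-+ˡ : (w w′ x : Vector ℝ m) → ⟨ (λ v → w v + w′ v) , x ⟩ ≈ ⟨ w , x ⟩ + ⟨ w′ , x ⟩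
    ⟨⟩-+ˡ w w′ x = trans (⟨⟩-comm _ x) (trans (⟨⟩-+ʳ x w w′) (+-cong (⟨⟩-comm x w) (⟨⟩-comm x w′)))

    ⟨⟩-*ˡ : ∀ r (w x : Vector ℝ m) → ⟨ (λ v → r * w v) , x ⟩ ≈ r * ⟨ w , x ⟩
    ⟨⟩-*ˡ r w x = trans (⟨⟩-comm _ x) (trans (⟨⟩-*ʳ r x w) (*-congˡ (⟨⟩-comm x w)))

    ⟨⟩-∑ʳ : ∀ {k} (w : Vector ℝ m) (c : Vector ℝ k) (a : Fin k → Vector ℝ m) →
            ⟨ w , (λ v → sum (λ i → c i * a i v)) ⟩ ≈ sum (λ i → c i * ⟨ w , a i ⟩)
    ⟨⟩-∑ʳ w c a = trans (∑-cong λ v → *-distribˡ-sum (w v) (λ i → c i * a i v))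
      (trans (∑-comm (λ v i → w v * (c i * a i v))) (∑-cong λ i → ⟨⟩-*ʳ (c i) w (a i)))

  module _ {m k : ℕ} (a : Fin k → Vector ℝ m) (b : Vector ℝ m) where

    InCone Separated : Set
    InCone    = Σ (Vector ℝ k) λ c → (∀ i → 0# ≤ c i) × (∀ v → b v ≈ sum (λ i → c i * a i v))
    Separated = Σ (Vector ℝ m) λ w → (∀ i → ⟨ w , a i ⟩ ≤ 0#) × ¬ (⟨ w , b ⟩ ≤ 0#)

  module _ {m k : ℕ} (a : Fin (suc k) → Vector ℝ m) (b x : Vector ℝ m) where

    -- the projection along a zero onto the kernel of x, when ⟨ x , a zero ⟩ ≈ 1#
    project : Vector ℝ m → Vector ℝ m
    project u v = u v + (- ⟨ x , u ⟩) * a zero v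

    -- Undoing the projection costs multiples of `a zero`: `- ⟨ x , a (suc i) ⟩` for each generator
    -- and `⟨ x , b ⟩` for b. The sign conditions make all of them nonnegative, so they add up to an
    -- admissible coefficient `c₀`.
    inCone-project : (∀ i → ⟨ x , a (suc i) ⟩ ≤ 0#) → 0# ≤ ⟨ x , b ⟩ →
                     InCone (project ∘ a ∘ suc) (project b) → InCone a b
    inCone-project x≤ xb≥0 (c , c≥0 , b′≈) =
      (c₀ Vector.∷ c) ,
      (λ { zero → +-nonNeg xb≥0 (∑-nonNeg λ i → *-nonNeg (c≥0 i) (neg-nonPos (x≤ i))) ; (suc i) → c≥0 i }) ,
      b≈
      where
      s : Fin k → ℝ
      s i = - ⟨ x , a (suc i) ⟩
      c₀ : ℝ
      c₀ = ⟨ x , b ⟩ + sum (λ i → c i * s i)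
      b≈ : ∀ v → b v ≈ c₀ * a zero v + sum (λ i → c i * a (suc i) v)
      b≈ v = trans
        (solve 3 (λ b t a₀ → b := (b :+ (:- t) :* a₀) :+ t :* a₀) refl (b v) ⟨ x , b ⟩ (a zero v))
        (trans (+-congʳ (trans (b′≈ v) (trans
          (∑-cong λ i → solve 4 (λ c a s a₀ → c :* (a :+ s :* a₀) := c :* a :+ (c :* s) :* a₀) refl
                          (c i) (a (suc i) v) (s i) (a zero v))
          (trans (∑-distrib-+ (λ i → c i * a (suc i) v) (λ i → (c i * s i) * a zero v))
                 (+-congˡ (sym (*-distribʳ-sum (a zero v) (λ i → c i * s i))))))))
        (solve 4 (λ A S a₀ t → (A :+ S :* a₀) :+ t :* a₀ := (t :+ S) :* a₀ :+ A) refl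
          (sum (λ i → c i * a (suc i) v)) (sum (λ i → c i * s i)) (a zero v) ⟨ x , b ⟩))

    -- The functional z is y precomposed with the projection; it vanishes on `a zero`, which the
    -- projection kills, and keeps the signs of y elsewhere.
    separated-project : ⟨ x , a zero ⟩ ≈ 1# → Separated (project ∘ a ∘ suc) (project b) → Separated a b
    separated-project xa₀≈1 (y , y≤ , b′≰) = z , z≤ , λ q → b′≰ (≤-respˡ-≈ (adjoint b) q)
      where
      t : ℝ
      t = - ⟨ y , a zero ⟩
      z : Vector ℝ m
      z v = y v + t * x v
      ⟨z⟩ : ∀ u → ⟨ z , u ⟩ ≈ ⟨ y , u ⟩ + t * ⟨ x , u ⟩
      ⟨z⟩ u = trans (⟨⟩-+ˡ y (λ v → t * x v) u) (+-congˡ (⟨⟩-*ˡ t x u))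
      adjoint : ∀ u → ⟨ z , u ⟩ ≈ ⟨ y , project u ⟩
      adjoint u = trans (⟨z⟩ u) (trans
        (solve 3 (λ yu ya xu → yu :+ (:- ya) :* xu := yu :+ (:- xu) :* ya) refl ⟨ y , u ⟩ ⟨ y , a zero ⟩ ⟨ x , u ⟩)
        (sym (trans (⟨⟩-+ʳ y u (λ v → (- ⟨ x , u ⟩) * a zero v)) (+-congˡ (⟨⟩-*ʳ (- ⟨ x , u ⟩) y (a zero))))))
      z≤ : ∀ i → ⟨ z , a i ⟩ ≤ 0#
      z≤ zero    = ≤-reflexive (trans (⟨z⟩ (a zero)) (trans (+-congˡ (*-congˡ xa₀≈1))
        (trans (+-congˡ (*-identityʳ _)) (-‿inverseʳ _))))
      z≤ (suc i) = ≤-respˡ-≈ (sym (adjoint (a (suc i)))) (y≤ i)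

  -- Bartl's induction on the number of vectors: a functional separating b from
  -- all vectors but a zero either is nonpositive on a zero too, or allows to
  -- project everything along a zero onto its kernel.
  farkas : ∀ {m k} (a : Fin k → Vector ℝ m) (b : Vector ℝ m) → InCone a b ⊎ Separated a b
  farkas {k = zero} a b with ⟨ b , b ⟩ ≤? 0#
  ... | yes p = inj₁ ((λ ()) , (λ ()) , λ v → x*x≤0⇒x≈0 (≤-trans (term≤∑ (λ v → x*x-nonNeg (b v)) v) p))
  ... | no  p = inj₂ (b , (λ ()) , p)
  farkas {m} {suc k} a b with farkas (a ∘ suc) b
  ... | inj₁ (c , c≥0 , b≈) =
        inj₁ ((0# Vector.∷ c) , (λ { zero → ≤-refl ; (suc i) → c≥0 i }) ,
              λ v → trans (b≈ v) (sym (trans (+-congʳ (zeroˡ _)) (+-identityˡ _))))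
  ... | inj₂ (x , x≤ , b≰) with ⟨ x , a zero ⟩ ≤? 0#
  ...   | yes p = inj₂ (x , (λ { zero → p ; (suc i) → x≤ i }) , b≰)
  ...   | no  p with positive-inverse p
  ...     | β , β≥0 , αβ≈1 with farkas (project a b βx ∘ a ∘ suc) (project a b βx b)
    where
    βx : Vector ℝ m
    βx v = β * x v
  ...       | inj₁ q = inj₁ (inCone-project a b (λ v → β * x v)
                (λ i → ≤-respˡ-≈ (sym (⟨⟩-*ˡ β x (a (suc i)))) (*-nonNeg-nonPos β≥0 (x≤ i)))
                (≤-respʳ-≈ (sym (⟨⟩-*ˡ β x b)) (*-nonNeg β≥0 (≰⇒≥ b≰))) q)
  ...       | inj₂ q = inj₂ (separated-project a b (λ v → β * x v)
                (trans (⟨⟩-*ˡ β x (a zero)) (trans (*-comm _ _) αβ≈1)) q)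

-- Support functions of polytopes and of virtual polytopes.

module Support (𝓡 : RealField) {n : ℕ} where
  open OrderedField 𝓡
  open Reals 𝓡 hiding (Point)
  open Polytope

  Point : Set
  Point = Vector ℝ n

  IsSupport : List Point → Point → ℝ → Set
  IsSupport ps w s = (∀ {p} → p ∈ ps → ⟨ w , p ⟩ ≤ s) × (∃ λ p → p ∈ ps × ⟨ w , p ⟩ ≈ s)

  support : ∀ ps → ps ≢ [] → ∀ w → ∃ (IsSupport ps w)
  support []           ps≢ w = contradiction ≡.refl ps≢
  support (p ∷ [])     ps≢ w = ⟨ w , p ⟩ , (λ { (here ≡.refl) → ≤-refl }) , p , here ≡.refl , refl
  support (p ∷ q ∷ ps) ps≢ w with support (q ∷ ps) (λ ()) w
  ... | s , upper , p′ , p′∈ , attained =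
    ⟨ w , p ⟩ ⊔ s ,
    (λ { (here ≡.refl) → x≤x⊔y _ s ; (there r∈) → ≤-trans (upper r∈) (x≤y⊔x _ s) }) ,
    [ (λ e → p , here ≡.refl , sym e) , (λ e → p′ , there p′∈ , trans attained (sym e)) ]′ (⊔-sel ⟨ w , p ⟩ s)

  -- abstract to let the unifier invert h
  abstract

    h : Polytope {n} → Point → ℝ
    h P w = proj₁ (support (points P) (nonempty P) w)

    ⟨⟩≤h : ∀ P {p} w → p ∈ points P → ⟨ w , p ⟩ ≤ h P w
    ⟨⟩≤h P w = proj₁ (proj₂ (support (points P) (nonempty P) w))

    h-attained : ∀ P w → ∃ λ p → p ∈ points P × ⟨ w , p ⟩ ≈ h P w
    h-attained P w = proj₂ (proj₂ (support (points P) (nonempty P) w))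

  h-lub : ∀ P w {s} → (∀ {p} → p ∈ points P → ⟨ w , p ⟩ ≤ s) → h P w ≤ s
  h-lub P w upper with h-attained P w
  ... | p , p∈ , e = ≤-respˡ-≈ e (upper p∈)

  h-unique : ∀ P w {s} → IsSupport (points P) w s → h P w ≈ s
  h-unique P w (upper , p , p∈ , e) = ≤-antisym (h-lub P w upper) (≤-respˡ-≈ e (⟨⟩≤h P w p∈))

  h-cong : ∀ P {w w′} → w ≈ₚ w′ → h P w ≈ h P w′
  h-cong P {w} {w′} e = h-unique P w
    ( (λ {p} p∈ → ≤-respˡ-≈ (⟨⟩-cong {x = p} (λ v → sym (e v)) (λ _ → refl)) (⟨⟩≤h P w′ p∈))
    , (let p , p∈ , f = h-attained P w′ in p , p∈ , trans (⟨⟩-cong {x = p} e (λ _ → refl)) f))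

  h-sublinear : ∀ P w w′ → h P (w +ₚ w′) ≤ h P w + h P w′
  h-sublinear P w w′ = h-lub P (w +ₚ w′) λ {p} p∈ →
    ≤-respˡ-≈ (sym (⟨⟩-+ˡ w w′ p)) (+-mono-≤ (⟨⟩≤h P w p∈) (⟨⟩≤h P w′ p∈))

  h-homogeneous : ∀ P {r} w → 0# ≤ r → h P (r *ₚ w) ≈ r * h P w
  h-homogeneous P {r} w r≥0 = h-unique P (r *ₚ w)
    ( (λ {p} p∈ → ≤-respˡ-≈ (sym (⟨⟩-*ˡ r w p)) (*-monoʳ-≤ r≥0 (⟨⟩≤h P w p∈)))
    , (let p , p∈ , e = h-attained P w in p , p∈ , trans (⟨⟩-*ˡ r w p) (*-congˡ e)))

  ⟦⟧⇒⟨⟩≤h : ∀ P {x} w → ⟦ P ⟧ x → ⟨ w , x ⟩ ≤ h P w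
  ⟦⟧⇒⟨⟩≤h P {x} w (k , c , a , c≥0 , a∈ , ∑c≈1 , x≈) = ≤-resp₂
    (sym (trans (⟨⟩-cong {w = w} (λ _ → refl) x≈) (⟨⟩-∑ʳ w c a)))
    (trans (sym (*-distribʳ-sum (h P w) c)) (trans (*-congʳ ∑c≈1) (*-identityˡ _)))
    (∑-mono λ i → *-monoʳ-≤ (c≥0 i) (⟨⟩≤h P w (a∈ i)))

  points⊆⟦⟧ : ∀ (P : Polytope {n}) {p} → p ∈ points P → ⟦ P ⟧ p
  points⊆⟦⟧ P {p} p∈ = 1 , (λ _ → 1#) , (λ _ → p) , (λ _ → 0≤1) , (λ _ → p∈) , +-identityʳ 1# ,
    λ v → sym (trans (+-identityʳ _) (*-identityˡ _))

  -- Homogenisation: a coordinate 1 is put in front of x and of every vertex, so that coefficients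
  -- in the cone sum to one. A separating functional then has a constant term `w zero` and a
  -- direction `w ∘ suc` in which x exceeds all vertices.
  ⟨⟩≤h⇒⟦⟧ : ∀ P {x} → (∀ w → ⟨ w , x ⟩ ≤ h P w) → ⟦ P ⟧ x
  ⟨⟩≤h⇒⟦⟧ P {x} below with farkas (λ i → 1# Vector.∷ List.lookup (points P) i) (1# Vector.∷ x)
  ... | inj₁ (c , c≥0 , eq) = _ , c , List.lookup (points P) , c≥0 , (λ i → ∈-lookup i) ,
          trans (∑-cong λ i → sym (*-identityʳ (c i))) (sym (eq zero)) , eq ∘ suc
  ... | inj₂ (w , w≤ , w≰) = contradiction
          (≤-resp₂ (trans (+-comm _ _) (+-congʳ (sym (*-identityʳ _)))) (-‿inverseˡ _)
            (+-mono-≤ (≤-trans (below (w ∘ suc)) (h-lub P (w ∘ suc) bound)) ≤-refl)) w≰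
    where
    bound : ∀ {p} → p ∈ points P → ⟨ w ∘ suc , p ⟩ ≤ - w zero
    bound {p} p∈ = 0≤-⇒≤ (≤-respʳ-≈ (trans (sym (-‿+-comm _ _)) (+-congʳ (-‿cong (*-identityʳ _))))
      (neg-nonPos (≡.subst (λ q → w zero * 1# + ⟨ w ∘ suc , q ⟩ ≤ 0#) (≡.sym (∈⇒lookup p∈)) (w≤ (Any.index p∈)))))
      where
      ∈⇒lookup : ∀ {ps} (p∈ : p ∈ ps) → p ≡ List.lookup ps (Any.index p∈)
      ∈⇒lookup (here e)  = e
      ∈⇒lookup (there i) = ∈⇒lookup i

  ≈ᴾ⇒h≈ : ∀ {P Q} → P ≈ᴾ Q → ∀ (w : Point) → h P w ≈ h Q w
  ≈ᴾ⇒h≈ {P} {Q} (P⊆Q , Q⊆P) w = ≤-antisym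
    (h-lub P w λ p∈ → ⟦⟧⇒⟨⟩≤h Q w (P⊆Q (points⊆⟦⟧ P p∈)))
    (h-lub Q w λ q∈ → ⟦⟧⇒⟨⟩≤h P w (Q⊆P (points⊆⟦⟧ Q q∈)))

  h≈⇒≈ᴾ : ∀ {P Q} → (∀ w → h P w ≈ h Q w) → P ≈ᴾ Q
  h≈⇒≈ᴾ {P} {Q} e =
    (λ x∈ → ⟨⟩≤h⇒⟦⟧ Q λ w → ≤-respʳ-≈ (e w) (⟦⟧⇒⟨⟩≤h P w x∈)) ,
    (λ x∈ → ⟨⟩≤h⇒⟦⟧ P λ w → ≤-respʳ-≈ (sym (e w)) (⟦⟧⇒⟨⟩≤h Q w x∈))

  h-⊕ : ∀ P Q w → h (P ⊕ Q) w ≈ h P w + h Q w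
  h-⊕ P Q w = h-unique (P ⊕ Q) w (upper , attained)
    where
    upper : ∀ {r} → r ∈ points (P ⊕ Q) → ⟨ w , r ⟩ ≤ h P w + h Q w
    upper r∈ with ∈-cartesianProductWith⁻ _+ₚ_ (points P) (points Q) r∈
    ... | p , q , p∈ , q∈ , ≡.refl = ≤-respˡ-≈ (sym (⟨⟩-+ʳ w p q)) (+-mono-≤ (⟨⟩≤h P w p∈) (⟨⟩≤h Q w q∈))
    attained : ∃ λ r → r ∈ points (P ⊕ Q) × ⟨ w , r ⟩ ≈ h P w + h Q w
    attained with h-attained P w | h-attained Q w
    ... | p , p∈ , e | q , q∈ , f =
      p +ₚ q , ∈-cartesianProductWith⁺ _+ₚ_ p∈ q∈ , trans (⟨⟩-+ʳ w p q) (+-cong e f)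

  h-⊙ : ∀ r P w → h (r ⊙ P) w ≈ h P (r *ₚ w)
  h-⊙ r P w = h-unique (r ⊙ P) w (upper , attained)
    where
    adjoint : ∀ p → ⟨ w , r *ₚ p ⟩ ≈ ⟨ r *ₚ w , p ⟩
    adjoint p = trans (⟨⟩-*ʳ r w p) (sym (⟨⟩-*ˡ r w p))
    upper : ∀ {q} → q ∈ points (r ⊙ P) → ⟨ w , q ⟩ ≤ h P (r *ₚ w)
    upper q∈ with ∈-map⁻ (r *ₚ_) q∈
    ... | p , p∈ , ≡.refl = ≤-respˡ-≈ (sym (adjoint p)) (⟨⟩≤h P (r *ₚ w) p∈)
    attained : ∃ λ q → q ∈ points (r ⊙ P) × ⟨ w , q ⟩ ≈ h P (r *ₚ w)
    attained with h-attained P (r *ₚ w)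
    ... | p , p∈ , e = r *ₚ p , ∈-map⁺ (r *ₚ_) p∈ , trans (adjoint p) e

  h-⊙-nonNeg : ∀ {r} P w → 0# ≤ r → h (r ⊙ P) w ≈ r * h P w
  h-⊙-nonNeg {r} P w r≥0 = trans (h-⊙ r P w) (h-homogeneous P w r≥0)

  h-𝟎 : ∀ w → h 𝟎 w ≈ 0#
  h-𝟎 w = h-unique 𝟎 w ((λ { (here ≡.refl) → ≤-reflexive ⟨w,0⟩≈0 }) , 0ₚ , here ≡.refl , ⟨w,0⟩≈0)
    where
    ⟨w,0⟩≈0 : ⟨ w , 0ₚ ⟩ ≈ 0#
    ⟨w,0⟩≈0 = ∑-zero λ v → zeroʳ (w v)

  singleton : Point → Polytope
  singleton p = record { points = p ∷ [] ; nonempty = λ () }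

  h-singleton : ∀ p w → h (singleton p) w ≈ ⟨ w , p ⟩
  h-singleton p w = h-unique (singleton p) w ((λ { (here ≡.refl) → ≤-refl }) , p , here ≡.refl , refl)

  ⟨⟩-𝐞 : ∀ (w : Point) u → ⟨ w , 𝐞 u ⟩ ≈ w u
  ⟨⟩-𝐞 w u = trans
    (∑-single u λ v v≢u → trans (*-congˡ (reflexive (≡.cong (if_then 1# else 0#)
      (dec-false (u Fin.≟ v) (v≢u ∘ ≡.sym))))) (zeroʳ _))
    (trans (*-congˡ (reflexive (≡.cong (if_then 1# else 0#) (dec-true (u Fin.≟ u) ≡.refl)))) (*-identityʳ _))

  h-segment-𝐞 : ∀ u v w → h (segment (𝐞 u) (𝐞 v)) w ≈ w u ⊔ w v
  h-segment-𝐞 u v w = h-unique (segment (𝐞 u) (𝐞 v)) w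
    ( (λ { (here ≡.refl)         → ≤-respˡ-≈ (sym (⟨⟩-𝐞 w u)) (x≤x⊔y _ _)
         ; (there (here ≡.refl)) → ≤-respˡ-≈ (sym (⟨⟩-𝐞 w v)) (x≤y⊔x _ _) })
    , [ (λ e → 𝐞 u , here ≡.refl , trans (⟨⟩-𝐞 w u) (sym e))
      , (λ e → 𝐞 v , there (here ≡.refl) , trans (⟨⟩-𝐞 w v) (sym e)) ]′ (⊔-sel (w u) (w v)))

  module _ (K : Subset n) .(ne : Nonempty K) where

    w≤h-△ : ∀ w {u} → u ∈ˢ K → w u ≤ h (△ K ne) w
    w≤h-△ w {u} u∈ = ≤-respˡ-≈ (⟨⟩-𝐞 w u)
      (⟨⟩≤h (△ K ne) w (∈-map⁺ 𝐞 (∈-filter⁺ (_∈? K) (∈-allFin u) u∈)))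

    h-△-attained : ∀ w → ∃ λ u → u ∈ˢ K × w u ≈ h (△ K ne) w
    h-△-attained w with h-attained (△ K ne) w
    ... | p , p∈ , e with ∈-map⁻ 𝐞 p∈
    ...   | u , u∈ , ≡.refl = u , proj₂ (∈-filter⁻ (_∈? K) {xs = allFin n} u∈) , trans (sym (⟨⟩-𝐞 w u)) e

    h-△-unique : ∀ w {s} → (∀ {u} → u ∈ˢ K → w u ≤ s) → (∃ λ u → u ∈ˢ K × w u ≈ s) → h (△ K ne) w ≈ s
    h-△-unique w upper (u , u∈ , e) with h-△-attained w
    ... | v , v∈ , f = ≤-antisym (≤-respˡ-≈ f (upper v∈)) (≤-respˡ-≈ e (w≤h-△ w u∈))

  module _ {A : Set} where

    ∑ₗ : (A → ℝ) → List A → ℝ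
    ∑ₗ f = foldr (λ x s → f x + s) 0#

    ∑ₗ-cong : ∀ {f g} xs → (∀ {x} → x ∈ xs → f x ≈ g x) → ∑ₗ f xs ≈ ∑ₗ g xs
    ∑ₗ-cong []       e = refl
    ∑ₗ-cong (x ∷ xs) e = +-cong (e (here ≡.refl)) (∑ₗ-cong xs (e ∘ there))

    ∑ₗ-+ : ∀ f g xs → ∑ₗ (λ x → f x + g x) xs ≈ ∑ₗ f xs + ∑ₗ g xs
    ∑ₗ-+ f g []       = sym (+-identityʳ 0#)
    ∑ₗ-+ f g (x ∷ xs) = trans (+-congˡ (∑ₗ-+ f g xs))
      (solve 4 (λ a b c d → (a :+ b) :+ (c :+ d) := (a :+ c) :+ (b :+ d)) refl (f x) (g x) (∑ₗ f xs) (∑ₗ g xs))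

    ∑ₗ-mono : ∀ {f g} xs → (∀ {x} → x ∈ xs → f x ≤ g x) → ∑ₗ f xs ≤ ∑ₗ g xs
    ∑ₗ-mono []       p = ≤-refl
    ∑ₗ-mono (x ∷ xs) p = +-mono-≤ (p (here ≡.refl)) (∑ₗ-mono xs (p ∘ there))

    -- The slack at one entry survives because no other entry loses anything. It will come from the
    -- edge that joins t to a maximiser of w on a clique.
    ∑ₗ-gap : ∀ {f g δ x₀} xs → (∀ {x} → x ∈ xs → f x ≤ g x) → x₀ ∈ xs →
             δ + f x₀ ≤ g x₀ → δ + ∑ₗ f xs ≤ ∑ₗ g xs
    ∑ₗ-gap (x ∷ xs) p (here ≡.refl) q = ≤-respˡ-≈ (+-assoc _ _ _) (+-mono-≤ q (∑ₗ-mono xs (p ∘ there)))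
    ∑ₗ-gap {f} {g} {δ} (x ∷ xs) p (there x₀∈) q = ≤-respˡ-≈
      (solve 3 (λ δ a s → a :+ (δ :+ s) := δ :+ (a :+ s)) refl δ (f x) (∑ₗ f xs))
      (+-mono-≤ (p (here ≡.refl)) (∑ₗ-gap xs (p ∘ there) x₀∈ q))

    ⨁ : (A → Polytope {n}) → List A → Polytope {n}
    ⨁ F = foldr (λ x Z → F x ⊕ Z) 𝟎

    h-⨁ : ∀ F xs w → h (⨁ F xs) w ≈ ∑ₗ (λ x → h (F x) w) xs
    h-⨁ F []       w = h-𝟎 w
    h-⨁ F (x ∷ xs) w = trans (h-⊕ (F x) (⨁ F xs) w) (+-congˡ (h-⨁ F xs w))

    module _ (F : A → Polytope {n}) where

      concatMap≢[] : ∀ {xs} → xs ≢ [] → concatMap (points ∘ F) xs ≢ []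
      concatMap≢[] {[]}     xs≢ _ = xs≢ ≡.refl
      concatMap≢[] {x ∷ xs} xs≢ e with points (F x) | nonempty (F x)
      ... | []    | ≢[] = ≢[] ≡.refl
      ... | _ ∷ _ | _   with () ← e

      -- Pooling the points gives the convex hull of the union, whose support function is the
      -- maximum of those of the parts.
      ⋃ : (xs : List A) → xs ≢ [] → Polytope
      ⋃ xs xs≢ = record { points = concatMap (points ∘ F) xs ; nonempty = concatMap≢[] xs≢ }

      h-⋃-unique : ∀ xs (xs≢ : xs ≢ []) w {s} → (∀ {x} → x ∈ xs → h (F x) w ≤ s) →
                   (∃ λ x → x ∈ xs × h (F x) w ≈ s) → h (⋃ xs xs≢) w ≈ s
      h-⋃-unique xs xs≢ w {s} upper (x , x∈ , e) = h-unique (⋃ xs xs≢) w (upper′ , attained)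
        where
        upper′ : ∀ {p} → p ∈ concatMap (points ∘ F) xs → ⟨ w , p ⟩ ≤ s
        upper′ p∈ with find (concatMap⁻ (points ∘ F) p∈)
        ... | y , y∈ , p∈Fy = ≤-trans (⟨⟩≤h (F y) w p∈Fy) (upper y∈)
        attained : ∃ λ p → p ∈ concatMap (points ∘ F) xs × ⟨ w , p ⟩ ≈ s
        attained with h-attained (F x) w
        ... | p , p∈ , f = p , concatMap⁺ (points ∘ F) (lose x∈ p∈) , trans f e

  hᵛ : VirtualPolytope → Point → ℝ
  hᵛ (P ⊖ Q) w = h P w - h Q w

  private
    module V = RawLeftModule (virtualPolytopes {n})

  ≈ⱽ⇒hᵛ≈ : ∀ {x y} → x ≈ⱽ y → ∀ w → hᵛ x w ≈ hᵛ y w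
  ≈ⱽ⇒hᵛ≈ {P₁ ⊖ Q₁} {P₂ ⊖ Q₂} e w = trans
    (solve 3 (λ p q r → p :- q := (p :+ r) :- (q :+ r)) refl (h P₁ w) (h Q₁ w) (h Q₂ w))
    (trans (+-congʳ (trans (sym (h-⊕ P₁ Q₂ w)) (trans (≈ᴾ⇒h≈ {P₁ ⊕ Q₂} {P₂ ⊕ Q₁} e w) (h-⊕ P₂ Q₁ w))))
    (solve 3 (λ p q r → (p :+ q) :- (q :+ r) := p :- r) refl (h P₂ w) (h Q₁ w) (h Q₂ w)))

  -- With its converse above, this makes `hᵛ` an embedding: identities of virtual polytopes are
  -- checked pointwise in the field, without invoking module laws of formal differences.
  hᵛ≈⇒≈ⱽ : ∀ {x y} → (∀ w → hᵛ x w ≈ hᵛ y w) → x ≈ⱽ y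
  hᵛ≈⇒≈ⱽ {P₁ ⊖ Q₁} {P₂ ⊖ Q₂} e = h≈⇒≈ᴾ {P₁ ⊕ Q₂} {P₂ ⊕ Q₁} λ w → trans (h-⊕ P₁ Q₂ w) (trans
    (solve 3 (λ p q r → p :+ r := (p :- q) :+ (q :+ r)) refl (h P₁ w) (h Q₁ w) (h Q₂ w))
    (trans (+-congʳ (e w)) (trans
    (solve 3 (λ p q r → (p :- r) :+ (q :+ r) := p :+ q) refl (h P₂ w) (h Q₁ w) (h Q₂ w))
    (sym (h-⊕ P₂ Q₁ w)))))

  hᵛ-+ : ∀ x y w → hᵛ (x V.+ᴹ y) w ≈ hᵛ x w + hᵛ y w
  hᵛ-+ (P₁ ⊖ Q₁) (P₂ ⊖ Q₂) w = trans (+-cong (h-⊕ P₁ P₂ w) (-‿cong (h-⊕ Q₁ Q₂ w)))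
    (solve 4 (λ a b c d → (a :+ b) :- (c :+ d) := (a :- c) :+ (b :- d)) refl
      (h P₁ w) (h P₂ w) (h Q₁ w) (h Q₂ w))

  hᵛ-· : ∀ r x w → hᵛ (r ·ⱽ x) w ≈ r * hᵛ x w
  hᵛ-· r (P ⊖ Q) w with 0# ≤? r
  ... | yes p = trans (+-cong (h-⊙-nonNeg P w p) (-‿cong (h-⊙-nonNeg Q w p)))
    (solve 3 (λ r a b → r :* a :- r :* b := r :* (a :- b)) refl r (h P w) (h Q w))
  ... | no  p = trans (+-cong (h-⊙-nonNeg Q w -r≥0) (-‿cong (h-⊙-nonNeg P w -r≥0)))
    (solve 3 (λ r a b → (:- r) :* b :- (:- r) :* a := r :* (a :- b)) refl r (h P w) (h Q w))
    where -r≥0 = neg-nonPos (≰⇒≥ p)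

  hᵛ-ι : ∀ P w → hᵛ (ι P) w ≈ h P w
  hᵛ-ι P w = trans (+-congˡ (trans (-‿cong (h-𝟎 w)) -0#≈0#)) (+-identityʳ _)

  open LinearAlgebra (virtualPolytopes {n}) public

  hᵛ-linearCombination : ∀ {k} (c : Vector ℝ k) x w →
                         hᵛ (linearCombination c x) w ≈ sum (λ i → c i * hᵛ (x i) w)
  hᵛ-linearCombination {zero}  c x w = -‿inverseʳ _
  hᵛ-linearCombination {suc k} c x w = trans
    (hᵛ-+ (c zero ·ⱽ x zero) (linearCombination (c ∘ suc) (x ∘ suc)) w)
    (+-cong (hᵛ-· (c zero) (x zero) w) (hᵛ-linearCombination (c ∘ suc) (x ∘ suc) w))

-- Removing vertices from subsets, and counting subsets.

lookup-∖-≡ : ∀ {n} (S : Subset n) u → lookup (S ∖ u) u ≡ false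
lookup-∖-≡ (s ∷ S) zero    = ≡.refl
lookup-∖-≡ (s ∷ S) (suc u) = lookup-∖-≡ S u

lookup-∖-≢ : ∀ {n} (S : Subset n) {u x} → x ≢ u → lookup (S ∖ u) x ≡ lookup S x
lookup-∖-≢ (s ∷ S) {zero}  {zero}  x≢u = contradiction ≡.refl x≢u
lookup-∖-≢ (s ∷ S) {zero}  {suc x} x≢u = ≡.cong (λ T → lookup T x) (p─⊥≡p S)
lookup-∖-≢ (s ∷ S) {suc u} {zero}  x≢u = ≡.refl
lookup-∖-≢ (s ∷ S) {suc u} {suc x} x≢u = lookup-∖-≢ S (x≢u ∘ ≡.cong suc)

x∉p∖x : ∀ {n} (S : Subset n) u → u ∉ˢ S ∖ u
x∉p∖x S u u∈ with () ← ≡.trans (≡.sym ([]=⇒lookup u∈)) (lookup-∖-≡ S u)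

p∖x⊆p : ∀ {n} (S : Subset n) u → S ∖ u ⊆ S
p∖x⊆p S u = p─q⊆p S _

⊆∖ : ∀ {n} {T S : Subset n} {u} → T ⊆ S → u ∉ˢ T → T ⊆ S ∖ u
⊆∖ T⊆S u∉ x∈ = x∈p∧x≢y⇒x∈p-y (T⊆S x∈) λ { ≡.refl → u∉ x∈ }

⊆∧∣∣≤⇒≡ : ∀ {n} {T S : Subset n} → T ⊆ S → ∣ S ∣ ≤ᴺ ∣ T ∣ → T ≡ S
⊆∧∣∣≤⇒≡ {T = T} {S} T⊆S S≤T = ⊆-antisym T⊆S S⊆T
  where
  S⊆T : S ⊆ T
  S⊆T {x} x∈S with x ∈? T
  ... | yes x∈T = x∈T
  ... | no  x∉T = contradiction S≤T (ℕ.<⇒≱ (p⊂q⇒∣p∣<∣q∣ (T⊆S , x , x∈S , x∉T)))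

_≟ˢ_ : ∀ {n} (S T : Subset n) → Dec (S ≡ T)
_≟ˢ_ = ≡-dec Bool._≟_

private
  split-head : ∀ {n} (P : Pred (Subset (suc n)) 0ℓ) →
               (Refinement (Subset n) (P ∘ (outside ∷_)) ⊎ Refinement (Subset n) (P ∘ (inside ∷_))) ↔
               Refinement (Subset (suc n)) P
  split-head P = mk↔ₛ′
    [ (λ (S , p) → outside ∷ S , p) , (λ (S , p) → inside ∷ S , p) ]′
    (λ { ((outside ∷ S) , p) → inj₁ (S , p) ; ((inside ∷ S) , p) → inj₂ (S , p) })
    (λ { ((outside ∷ S) , p) → ≡.refl ; ((inside ∷ S) , p) → ≡.refl })
    (λ { (inj₁ _) → ≡.refl ; (inj₂ _) → ≡.refl })

-- The proof of P is irrelevant in `Refinement`, so the bijection counts subsets and not proofs.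
enumerate : ∀ n (P : Pred (Subset n) 0ℓ) → Decidable P → ∃ λ d → Fin d ↔ Refinement (Subset n) P
enumerate zero P P? with P? []
... | yes p = 1 , mk↔ₛ′ (λ _ → [] , [ p ]) (λ _ → zero) (λ { ([] , _) → ≡.refl }) (λ { zero → ≡.refl })
... | no ¬p = 0 , mk↔ₛ′ (λ ()) (λ { ([] , [ p ]) → contradiction-irr p ¬p })
                            (λ { ([] , [ p ]) → contradiction-irr p ¬p }) (λ ())
enumerate (suc n) P P? =
  let d , φ = enumerate n (P ∘ (outside ∷_)) (P? ∘ (outside ∷_))
      e , ψ = enumerate n (P ∘ (inside ∷_)) (P? ∘ (inside ∷_))
  in d ℕ.+ e , (split-head P ↔-∘ ((φ ⊎-cong ψ) ↔-∘ Fin.+↔⊎))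

-- Cliques and non-edges.

module Cliques {n : ℕ} (G : SimpleGraph n) where
  open SimpleGraph G using (Adj; adj?)

  nonEdge? : (S : Subset n) → NonEdgeIn G S ⊎ InducesClique G S
  nonEdge? S with Fin.any? (λ u → Fin.any? λ v → u ∈? S ×-dec v ∈? S ×-dec ¬? (u Fin.≟ v) ×-dec ¬? (adj? u v))
  ... | yes (u , v , u∈ , v∈ , u≢v , ¬adj) =
          inj₁ record { u = u ; v = v ; u∈S = u∈ ; v∈S = v∈ ; distinct = u≢v ; notAdj = ¬adj }
  ... | no  none = inj₂ clique
    where
    clique : InducesClique G S
    clique {u} {v} u∈ v∈ u≢v with adj? u v
    ... | yes adj = adj
    ... | no ¬adj = contradiction (u , v , u∈ , v∈ , u≢v , ¬adj) none

  nonEdge⇒¬clique : ∀ {S} → NonEdgeIn G S → ¬ InducesClique G S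
  nonEdge⇒¬clique e clique = notAdj (clique u∈S v∈S distinct)
    where open NonEdgeIn e

  clique? : Decidable (InducesClique G)
  clique? S with nonEdge? S
  ... | inj₁ e = no (nonEdge⇒¬clique e)
  ... | inj₂ c = yes c

  -- A canonical choice of pairs: the basis and the dimension come without a given choice, but their
  -- proofs interpolate along one.
  nonEdge : (S : NonClique G) → NonEdgeIn G (NonClique.set S)
  nonEdge record { set = S ; notClique = ¬c } with nonEdge? S
  ... | inj₁ e = e
  ... | inj₂ c = ⊥-elim-irr (¬c c)

  module _ {S : Subset n} (e : NonEdgeIn G S) where
    open NonEdgeIn e

    v∈S∖u : v ∈ˢ S ∖ u
    v∈S∖u = x∈p∧x≢y⇒x∈p-y v∈S (distinct ∘ ≡.sym)

    ∣S∖u∣<∣S∣ : ∣ S ∖ u ∣ <ᴺ ∣ S ∣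
    ∣S∖u∣<∣S∣ = x∈p⇒∣p-x∣<∣p∣ u∈S

    ∣S∖v∣<∣S∣ : ∣ S ∖ v ∣ <ᴺ ∣ S ∣
    ∣S∖v∣<∣S∣ = x∈p⇒∣p-x∣<∣p∣ v∈S

    ∣S∖u∖v∣<∣S∖u∣ : ∣ S ∖ u ∖ v ∣ <ᴺ ∣ S ∖ u ∣
    ∣S∖u∖v∣<∣S∖u∣ = x∈p⇒∣p-x∣<∣p∣ v∈S∖u

    ∣S∖u∖v∣<∣S∣ : ∣ S ∖ u ∖ v ∣ <ᴺ ∣ S ∣
    ∣S∖u∖v∣<∣S∣ = ℕ.<-trans ∣S∖u∖v∣<∣S∖u∣ ∣S∖u∣<∣S∣

    nonEdge⇒NonClique : NonClique G
    nonEdge⇒NonClique = record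
      { set       = S
      -- Removing u and then v lowers the size strictly twice.
      ; size≥2    = ℕ.≤-trans (s≤s (ℕ.≤-trans (s≤s z≤n) ∣S∖u∖v∣<∣S∖u∣)) ∣S∖u∣<∣S∣
      ; notClique = nonEdge⇒¬clique e
      }

  nonemptyᴷ : (K : NonemptyClique G) → Nonempty (NonemptyClique.set K)
  nonemptyᴷ record { set = K ; nonempty = ne } = recompute (nonempty? K) ne

  cliqueᴷ : (K : NonemptyClique G) → InducesClique G (NonemptyClique.set K)
  cliqueᴷ record { set = K ; clique = c } = recompute (clique? K) c

  set-injective : ∀ {K L : NonemptyClique G} → NonemptyClique.set K ≡ NonemptyClique.set L → K ≡ L
  set-injective ≡.refl = ≡.refl

  cliques : ∃ λ d → Fin d ↔ NonemptyClique G
  cliques = let d , φ = enumerate n _ (λ S → nonempty? S ×-dec clique? S) in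
    d , (mk↔ₛ′
      (λ { (S , [ p ]) → record { set = S ; nonempty = proj₁ p ; clique = proj₂ p } })
      (λ { record { set = S ; nonempty = ne ; clique = c } → S , [ ne , c ] })
      (λ _ → ≡.refl) (λ _ → ≡.refl) ↔-∘ φ)

-- Unitriangular systems graded by a rank.

module Triangular (𝓡 : RealField) where
  open OrderedField 𝓡

  module _ {d : ℕ} (ρ : Fin d → ℕ) (M : Fin d → Fin d → ℝ)
           (diagonal : ∀ i → M i i ≈ 1#)
           (vanishes : ∀ i j → j ≢ i → ρ i ≤ᴺ ρ j → M i j ≈ 0#)
           where

    private
      -- Every off-diagonal term dies: through c if its rank is smaller than that of i, through M
      -- otherwise. Indices of equal rank do not interact, so the rank need not be injective.
      row : ∀ i (c : Vector ℝ d) → (∀ j → ρ j <ᴺ ρ i → c j ≈ 0#) → sum (λ j → M i j * c j) ≈ c i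
      row i c c≈0 = trans (∑-single i off) (trans (*-congʳ (diagonal i)) (*-identityˡ _))
        where
        off : ∀ j → j ≢ i → M i j * c j ≈ 0#
        off j j≢i with ρ j ℕ.<? ρ i
        ... | yes p = trans (*-congˡ (c≈0 j p)) (zeroʳ _)
        ... | no  p = trans (*-congʳ (vanishes i j j≢i (ℕ.≮⇒≥ p))) (zeroˡ _)

    triangular-injective : ∀ (c : Vector ℝ d) → (∀ i → sum (λ j → M i j * c j) ≈ 0#) → ∀ i → c i ≈ 0#
    triangular-injective c Mc≈0 i = below (suc (ρ i)) i ℕ.≤-refl
      where
      below : ∀ m i → ρ i <ᴺ m → c i ≈ 0#
      below (suc m) i (s≤s ρi≤m) =
        trans (sym (row i c λ j ρj<ρi → below m j (ℕ.<-≤-trans ρj<ρi ρi≤m))) (Mc≈0 i)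

    -- Each round of the iteration y ↦ y + (b - M y) annihilates the residual
    -- in one more rank.
    triangular-surjective : ∀ N → (∀ i → ρ i <ᴺ N) → ∀ (b : Vector ℝ d) →
                            Σ (Vector ℝ d) λ y → ∀ i → b i ≈ sum (λ j → M i j * y j)
    triangular-surjective N ρ<N b = y N , λ i →
      trans (solve 2 (λ b s → b := (b :- s) :+ s) refl (b i) (sum (λ j → M i j * y N j)))
            (trans (+-congʳ (residual≈0 N i (ρ<N i))) (+-identityˡ _))
      where
      y residual : ℕ → Vector ℝ d
      y zero    i = 0#
      y (suc m) i = y m i + residual m i
      residual m i = b i - sum (λ j → M i j * y m j)

      residual-suc : ∀ m i → residual (suc m) i ≈ residual m i - sum (λ j → M i j * residual m j)
      residual-suc m i = trans
        (+-congˡ (-‿cong (trans (∑-cong λ j → distribˡ (M i j) (y m j) (residual m j))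
          (∑-distrib-+ (λ j → M i j * y m j) (λ j → M i j * residual m j)))))
        (solve 3 (λ b s r → b :- (s :+ r) := (b :- s) :- r) refl
          (b i) (sum (λ j → M i j * y m j)) (sum (λ j → M i j * residual m j)))

      residual≈0 : ∀ m i → ρ i <ᴺ m → residual m i ≈ 0#
      residual≈0 (suc m) i (s≤s ρi≤m) = trans (residual-suc m i)
        (trans (+-congˡ (-‿cong (row i (residual m) λ j ρj<ρi → residual≈0 m j (ℕ.<-≤-trans ρj<ρi ρi≤m))))
               (-‿inverseʳ _))

-- Interpolating modular set functions by clique indicators.

module Interpolation (𝓡 : RealField) {n : ℕ} (G : SimpleGraph n) where
  open OrderedField 𝓡
  open Triangular 𝓡
  open Cliques G

  -- abstract to keep case distinctions on T ⊆? S from rewriting it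
  abstract

    𝟙[_⊆_] : Subset n → Subset n → ℝ
    𝟙[ T ⊆ S ] = if does (T ⊆? S) then 1# else 0#

    𝟙[⊆]≈1 : ∀ {T S} → T ⊆ S → 𝟙[ T ⊆ S ] ≈ 1#
    𝟙[⊆]≈1 {T} {S} p = reflexive (≡.cong (if_then 1# else 0#) (dec-true (T ⊆? S) p))

    𝟙[⊆]≈0 : ∀ {T S} → ¬ (T ⊆ S) → 𝟙[ T ⊆ S ] ≈ 0#
    𝟙[⊆]≈0 {T} {S} p = reflexive (≡.cong (if_then 1# else 0#) (dec-false (T ⊆? S) p))

  -- Stated for an arbitrary non-edge, so that it can be assumed of g at the chosen pairs only and
  -- proved for clique indicators at all pairs.
  ModularAt : ∀ {S} → NonEdgeIn G S → (Subset n → ℝ) → Set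
  ModularAt {S} e g = g (S ∖ u) + g (S ∖ v) ≈ g S + g (S ∖ u ∖ v)
    where open NonEdgeIn e

  -- A clique T misses u or v, and removing a vertex outside T does not affect whether T fits; the
  -- four terms therefore cancel in pairs.
  𝟙[clique⊆]-modular : ∀ {T S} → InducesClique G T → (e : NonEdgeIn G S) → ModularAt e (λ S → 𝟙[ T ⊆ S ])
  𝟙[clique⊆]-modular {T} {S} clique e with T ⊆? S | NonEdgeIn.u e ∈? T | NonEdgeIn.v e ∈? T
  ... | no  T⊈ | _      | _      = +-cong
        (trans (𝟙[⊆]≈0 λ q → T⊈ (p∖x⊆p S _ ∘ q)) (sym (𝟙[⊆]≈0 T⊈)))
        (trans (𝟙[⊆]≈0 λ q → T⊈ (p∖x⊆p S _ ∘ q)) (sym (𝟙[⊆]≈0 λ q → T⊈ (p∖x⊆p S _ ∘ p∖x⊆p _ _ ∘ q))))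
  ... | yes T⊆ | yes u∈ | yes v∈ = contradiction (clique u∈ v∈ (NonEdgeIn.distinct e)) (NonEdgeIn.notAdj e)
  ... | yes T⊆ | yes u∈ | no  v∉ = trans (+-comm _ _) (+-cong
        (trans (𝟙[⊆]≈1 (⊆∖ T⊆ v∉)) (sym (𝟙[⊆]≈1 T⊆)))
        (trans (𝟙[⊆]≈0 λ q → x∉p∖x S _ (q u∈)) (sym (𝟙[⊆]≈0 λ q → x∉p∖x S _ (p∖x⊆p _ _ (q u∈))))))
  ... | yes T⊆ | no  u∉ | yes v∈ = +-cong
        (trans (𝟙[⊆]≈1 (⊆∖ T⊆ u∉)) (sym (𝟙[⊆]≈1 T⊆)))
        (trans (𝟙[⊆]≈0 λ q → x∉p∖x S _ (q v∈)) (sym (𝟙[⊆]≈0 λ q → x∉p∖x _ _ (q v∈))))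
  ... | yes T⊆ | no  u∉ | no  v∉ = +-cong
        (trans (𝟙[⊆]≈1 (⊆∖ T⊆ u∉)) (sym (𝟙[⊆]≈1 T⊆)))
        (trans (𝟙[⊆]≈1 (⊆∖ T⊆ v∉)) (sym (𝟙[⊆]≈1 (⊆∖ (⊆∖ T⊆ u∉) v∉))))

  -- Containment in a set that is no larger is equality, so sizes serve as ranks.
  𝟙[φ⊆φ]-vanishes : ∀ {k} (φ : Fin k → NonemptyClique G) → Injective _≡_ _≡_ φ → ∀ i j → j ≢ i →
                 let set = NonemptyClique.set in
                 ∣ set (φ i) ∣ ≤ᴺ ∣ set (φ j) ∣ → 𝟙[ set (φ j) ⊆ set (φ i) ] ≈ 0#
  𝟙[φ⊆φ]-vanishes φ φ-inj i j j≢i size≤ =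
    𝟙[⊆]≈0 λ q → j≢i (φ-inj (set-injective (⊆∧∣∣≤⇒≡ q size≤)))

  dim : ℕ
  dim = proj₁ cliques

  private
    module Enumeration = Inverse (proj₂ cliques)
  open Enumeration public using () renaming (to to φ; from to φ⁻¹)

  K : Fin dim → Subset n
  K i = NonemptyClique.set (φ i)

  φ-injective : Injective _≡_ _≡_ φ
  φ-injective {i} {j} e = ≡.trans (≡.sym (Enumeration.strictlyInverseʳ i))
                                  (≡.trans (≡.cong φ⁻¹ e) (Enumeration.strictlyInverseʳ j))

  module _ (choice : (S : NonClique G) → NonEdgeIn G (NonClique.set S)) (g : Subset n → ℝ)
           (g⊥≈0 : g ⊥ ≈ 0#)
           (modular : ∀ S → ModularAt (choice S) g)
           where

    -- On cliques g is met by solving a triangular system; the equations then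
    -- determine both sides on every other set from smaller ones.
    interpolation : Σ (Vector ℝ dim) λ y → ∀ S → g S ≈ sum (λ i → y i * 𝟙[ K i ⊆ S ])
    interpolation = y , λ S → agree (suc ∣ S ∣) S ℕ.≤-refl
      where
      solution = triangular-surjective (λ i → ∣ K i ∣) (λ i j → 𝟙[ K j ⊆ K i ])
        (λ i → 𝟙[⊆]≈1 (λ x∈ → x∈)) (𝟙[φ⊆φ]-vanishes φ φ-injective)
        (suc n) (λ i → s≤s (∣p∣≤n (K i))) (g ∘ K)
      y : Vector ℝ dim
      y = proj₁ solution

      F : Subset n → ℝ
      F S = sum (λ i → y i * 𝟙[ K i ⊆ S ])

      g≈F-on-cliques : ∀ {S} → Nonempty S → InducesClique G S → g S ≈ F S
      g≈F-on-cliques {S} ne c = ≡.subst (λ T → g T ≈ F T) (≡.cong NonemptyClique.set (Enumeration.strictlyInverseˡ L))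
        (trans (proj₂ solution (φ⁻¹ L)) (∑-cong {dim} λ j → *-comm 𝟙[ K j ⊆ K (φ⁻¹ L) ] (y j)))
        where
        L : NonemptyClique G
        L = record { set = S ; nonempty = ne ; clique = c }

      F-modular : ∀ {S} (e : NonEdgeIn G S) → ModularAt e F
      F-modular {S} e = trans (sym (∑-distrib-+ (λ i → y i * 𝟙[ K i ⊆ S ∖ u ]) (λ i → y i * 𝟙[ K i ⊆ S ∖ v ])))
        (trans (∑-cong λ i → trans (sym (distribˡ (y i) _ _))
          (trans (*-congˡ (𝟙[clique⊆]-modular (cliqueᴷ (φ i)) e)) (distribˡ (y i) _ _)))
        (∑-distrib-+ (λ i → y i * 𝟙[ K i ⊆ S ]) (λ i → y i * 𝟙[ K i ⊆ S ∖ u ∖ v ])))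
        where open NonEdgeIn e

      agree : ∀ m S → ∣ S ∣ <ᴺ m → g S ≈ F S
      agree (suc m) S (s≤s ∣S∣≤m) with nonempty? S | nonEdge? S
      -- No nonempty clique fits into the empty set, so F vanishes there; hence the normalisation
      -- `g⊥≈0`.
      ... | no  empty | _      = trans (trans (reflexive (≡.cong g (Empty-unique empty))) g⊥≈0)
            (sym (∑-zero λ i → trans (*-congˡ (𝟙[⊆]≈0 λ q →
              let x , x∈ = nonemptyᴷ (φ i) in empty (x , q x∈))) (zeroʳ _)))
      ... | yes ne    | inj₂ c = g≈F-on-cliques ne c
      -- The pair `e₀` only certifies that S is a non-clique; the equation known for g is the one at
      -- the chosen pair e.
      ... | yes ne    | inj₁ e₀ = trans (rearrange (modular C)) (trans
            (+-cong (+-cong (smaller (∣S∖u∣<∣S∣ e)) (smaller (∣S∖v∣<∣S∣ e))) (-‿cong (smaller (∣S∖u∖v∣<∣S∣ e))))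
            (sym (rearrange (F-modular e))))
        where
        C = nonEdge⇒NonClique e₀
        e = choice C
        smaller : ∀ {T} → ∣ T ∣ <ᴺ ∣ S ∣ → g T ≈ F T
        smaller {T} p = agree m T (ℕ.<-≤-trans p ∣S∣≤m)
        rearrange : ∀ {a b c d} → a + b ≈ c + d → c ≈ (a + b) - d
        rearrange {a} {b} {c} {d} p = trans (solve 2 (λ c d → c := (c :+ d) :- d) refl c d) (+-congʳ (sym p))

-- Deformations of the zonotope and their fan-linear support functions.

module Deformations (𝓡 : RealField) {n : ℕ} (G : SimpleGraph n) where
  open OrderedField 𝓡
  open Reals 𝓡 hiding (Point; module LinearAlgebra)
  open Support 𝓡 {n}
  open SimpleGraph G using (Adj; adj?; irrefl) renaming (sym to Adj-sym)
  open Cliques G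

  Z : Polytope {n}
  Z = zonotope G

  SameOrder : Point → Point → Fin n → Fin n → Set
  SameOrder w w′ u v = (w u ≤ w v × w′ u ≤ w′ v) ⊎ (w v ≤ w u × w′ v ≤ w′ u)

  -- The functions that are linear on every cone of the normal fan of Z
  record FanLinear (f : Point → ℝ) : Set where
    field
      cong        : ∀ {w w′} → w ≈ₚ w′ → f w ≈ f w′
      homogeneous : ∀ {r} w → 0# ≤ r → f (r *ₚ w) ≈ r * f w
      additive    : ∀ w w′ → (∀ {u v} → Adj u v → SameOrder w w′ u v) → f (w +ₚ w′) ≈ f w + f w′

  FanLinear-∑ : ∀ {k} (c : Vector ℝ k) {f : Fin k → Point → ℝ} → (∀ i → FanLinear (f i)) →
                FanLinear (λ w → sum (λ i → c i * f i w))
  FanLinear-∑ c {f} F = record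
    { cong        = λ p → ∑-cong λ i → *-congˡ (FanLinear.cong (F i) p)
    ; homogeneous = λ {r} w r≥0 → trans
        (∑-cong λ i → trans (*-congˡ (FanLinear.homogeneous (F i) w r≥0))
          (solve 3 (λ c r x → c :* (r :* x) := r :* (c :* x)) refl (c i) r (f i w)))
        (sym (*-distribˡ-sum r (λ i → c i * f i w)))
    ; additive    = λ w w′ o → trans
        (∑-cong λ i → trans (*-congˡ (FanLinear.additive (F i) w w′ o)) (distribˡ (c i) (f i w) (f i w′)))
        (∑-distrib-+ (λ i → c i * f i w) (λ i → c i * f i w′))
    }

  FanLinear-- : ∀ {f g} → FanLinear f → FanLinear g → FanLinear (λ w → f w - g w)
  FanLinear-- {f} {g} F H = record
    { cong        = λ p → +-cong (F.cong p) (-‿cong (H.cong p))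
    ; homogeneous = λ {r} w r≥0 → trans (+-cong (F.homogeneous w r≥0) (-‿cong (H.homogeneous w r≥0)))
        (solve 3 (λ r a b → r :* a :- r :* b := r :* (a :- b)) refl r (f w) (g w))
    ; additive    = λ w w′ o → trans (+-cong (F.additive w w′ o) (-‿cong (H.additive w w′ o)))
        (solve 4 (λ a a′ b b′ → (a :+ a′) :- (b :+ b′) := (a :- b) :+ (a′ :- b′)) refl
          (f w) (f w′) (g w) (g w′))
    }
    where
    module F = FanLinear F
    module H = FanLinear H

  edge⇒Adj : ∀ {u v} → (u , v) ∈ edges G → Adj u v
  edge⇒Adj e∈ = proj₂ (proj₂ (∈-filter⁻ (λ (u , v) → (u Fin.<? v) ×-dec adj? u v)
                                {xs = List.cartesianProduct (allFin n) (allFin n)} e∈))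

  Adj⇒edge : ∀ {u v} → Adj u v → (u , v) ∈ edges G ⊎ (v , u) ∈ edges G
  Adj⇒edge {u} {v} adj with Fin.<-cmp u v
  ... | tri< u<v _ _  = inj₁ (∈-filter⁺ _ (∈-cartesianProduct⁺ (∈-allFin u) (∈-allFin v)) (u<v , adj))
  ... | tri≈ _ u≡v _ = contradiction adj (irrefl u≡v)
  ... | tri> _ _ v<u  = inj₂ (∈-filter⁺ _ (∈-cartesianProduct⁺ (∈-allFin v) (∈-allFin u)) (v<u , Adj-sym adj))

  maxEnd : Point → Fin n × Fin n → ℝ
  maxEnd w (u , v) = w u ⊔ w v

  h-Z : ∀ w → h Z w ≈ ∑ₗ (maxEnd w) (edges G)
  h-Z w = trans (h-⨁ (λ (u , v) → segment (𝐞 u) (𝐞 v)) (edges G) w)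
                (∑ₗ-cong (edges G) λ {(u , v)} _ → h-segment-𝐞 u v w)

  -- On each edge one and the same end carries the maximum for both vectors, and hence for their
  -- sum.
  h-Z-additive : ∀ w w′ → (∀ {u v} → Adj u v → SameOrder w w′ u v) → h Z (w +ₚ w′) ≈ h Z w + h Z w′
  h-Z-additive w w′ o = trans (h-Z (w +ₚ w′)) (trans
    (trans (∑ₗ-cong (edges G) λ e∈ → maxEnd-additive (o (edge⇒Adj e∈))) (∑ₗ-+ (maxEnd w) (maxEnd w′) (edges G)))
    (sym (+-cong (h-Z w) (h-Z w′))))
    where
    maxEnd-additive : ∀ {u v} → SameOrder w w′ u v → maxEnd (w +ₚ w′) (u , v) ≈ maxEnd w (u , v) + maxEnd w′ (u , v)
    maxEnd-additive (inj₁ (p , p′)) = trans (x≤y⇒x⊔y≈y (+-mono-≤ p p′))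
      (sym (+-cong (x≤y⇒x⊔y≈y p) (x≤y⇒x⊔y≈y p′)))
    maxEnd-additive (inj₂ (p , p′)) = trans (trans (⊔-comm _ _) (x≤y⇒x⊔y≈y (+-mono-≤ p p′)))
      (sym (+-cong (trans (⊔-comm _ _) (x≤y⇒x⊔y≈y p)) (trans (⊔-comm _ _) (x≤y⇒x⊔y≈y p′))))

  DC⇒h : ∀ {P} → DC Z P → ∃₂ λ r Q → 0# ≤ r × (∀ w → h P w + h Q w ≈ r * h Z w)
  DC⇒h {P} (r , Q , r≥0 , e) = r , Q , r≥0 , λ w →
    trans (sym (h-⊕ P Q w)) (trans (≈ᴾ⇒h≈ {P ⊕ Q} {r ⊙ Z} e w) (h-⊙-nonNeg Z w r≥0))

  h⇒DC : ∀ {P r} Q → 0# ≤ r → (∀ w → h P w + h Q w ≈ r * h Z w) → DC Z P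
  h⇒DC {P} {r} Q r≥0 e = r , Q , r≥0 , h≈⇒≈ᴾ {P ⊕ Q} {r ⊙ Z} λ w →
    trans (h-⊕ P Q w) (trans (e w) (sym (h-⊙-nonNeg Z w r≥0)))

  private
    superadditive : ∀ {p p′ q q′ p″ q″ x y} → p + q ≈ x → p′ + q′ ≈ y → p″ + q″ ≈ x + y → q″ ≤ q + q′ → p + p′ ≤ p″
    superadditive {p} {p′} {q} {q′} {p″} {q″} e e′ e″ q″≤ = ≤-resp₂
      (trans (+-congʳ (trans e″ (sym (+-cong e e′))))
        (solve 4 (λ p p′ q q′ → ((p :+ q) :+ (p′ :+ q′)) :- (q :+ q′) := p :+ p′) refl p p′ q q′))
      (solve 2 (λ p q → (p :+ q) :- q := p) refl p″ q″)
      (+-monoʳ-≤ (p″ + q″) (neg-mono-≤ q″≤))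

  -- Where `h Z` is additive, `h P`, which is r times `h Z` minus `h Q`, is superadditive because
  -- `h Q` is subadditive; but `h P` is subadditive too.
  DC⇒FanLinear : ∀ {P} → DC Z P → FanLinear (h P)
  DC⇒FanLinear {P} P∈ = let r , Q , r≥0 , e = DC⇒h {P} P∈ in record
    { cong        = h-cong P
    ; homogeneous = h-homogeneous P
    ; additive    = λ w w′ o → ≤-antisym (h-sublinear P w w′)
        (superadditive (e w) (e w′)
          (trans (e (w +ₚ w′)) (trans (*-congˡ (h-Z-additive w w′ o)) (distribˡ r (h Z w) (h Z w′))))
          (h-sublinear Q w w′))
    }

  DC-𝟎 : DC Z 𝟎
  DC-𝟎 = h⇒DC {𝟎} 𝟎 ≤-refl λ w → trans (+-cong (h-𝟎 w) (h-𝟎 w)) (trans (+-identityʳ 0#) (sym (zeroˡ _)))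

  DC-⊕ : ∀ {P P′} → DC Z P → DC Z P′ → DC Z (P ⊕ P′)
  DC-⊕ {P} {P′} P∈ P′∈ = let r , Q , r≥0 , e = DC⇒h {P} P∈ ; r′ , Q′ , r′≥0 , e′ = DC⇒h {P′} P′∈ in
    h⇒DC {P ⊕ P′} (Q ⊕ Q′) (+-nonNeg r≥0 r′≥0) λ w →
    trans (+-cong (h-⊕ P P′ w) (h-⊕ Q Q′ w)) (trans
      (solve 4 (λ p p′ q q′ → (p :+ p′) :+ (q :+ q′) := (p :+ q) :+ (p′ :+ q′)) refl
        (h P w) (h P′ w) (h Q w) (h Q′ w))
      (trans (+-cong (e w) (e′ w)) (sym (distribʳ (h Z w) r r′))))

  DC-⊙ : ∀ {s P} → 0# ≤ s → DC Z P → DC Z (s ⊙ P)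
  DC-⊙ {s} {P} s≥0 P∈ = let r , Q , r≥0 , e = DC⇒h {P} P∈ in
    h⇒DC {s ⊙ P} (s ⊙ Q) (*-nonNeg s≥0 r≥0) λ w →
    trans (+-cong (h-⊙-nonNeg P w s≥0) (h-⊙-nonNeg Q w s≥0))
      (trans (sym (distribˡ s (h P w) (h Q w))) (trans (*-congˡ (e w)) (sym (*-assoc s r (h Z w)))))

  -- Z is centrally symmetric up to the translation by the sum of its vertices 𝐞 u + 𝐞 v over all edges
  DC-reflect : ∀ {P} → DC Z P → DC Z ((- 1#) ⊙ P)
  DC-reflect {P} P∈ = let r , Q , r≥0 , e = DC⇒h {P} P∈ in
    h⇒DC {(- 1#) ⊙ P} (((- 1#) ⊙ Q) ⊕ (r ⊙ C)) r≥0 λ w →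
    trans (+-cong (h-⊙ (- 1#) P w) (trans (h-⊕ _ _ w) (+-cong (h-⊙ (- 1#) Q w)
                    (trans (h-⊙-nonNeg C w r≥0) (*-congˡ (h-C w))))))
      (trans (sym (+-assoc _ _ _)) (trans (+-congʳ (e ((- 1#) *ₚ w))) (trans (sym (distribˡ r _ _))
        (*-congˡ (trans (+-congʳ (h-Z ((- 1#) *ₚ w)))
          (trans (sym (∑ₗ-+ (maxEnd ((- 1#) *ₚ w)) (λ (u , v) → w u + w v) (edges G)))
          (trans (∑ₗ-cong (edges G) λ {(u , v)} _ → reflect (w u) (w v)) (sym (h-Z w)))))))))
    where
    C : Polytope {n}
    C = ⨁ (λ (u , v) → singleton (𝐞 u +ₚ 𝐞 v)) (edges G)
    h-C : ∀ w → h C w ≈ ∑ₗ (λ (u , v) → w u + w v) (edges G)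
    h-C w = trans (h-⨁ (λ (u , v) → singleton (𝐞 u +ₚ 𝐞 v)) (edges G) w)
      (∑ₗ-cong (edges G) λ {(u , v)} _ → trans (h-singleton (𝐞 u +ₚ 𝐞 v) w)
        (trans (⟨⟩-+ʳ w (𝐞 u) (𝐞 v)) (+-cong (⟨⟩-𝐞 w u) (⟨⟩-𝐞 w v))))
    -1*-antimono : ∀ {x y} → x ≤ y → (- 1#) * y ≤ (- 1#) * x
    -1*-antimono {x} {y} p = ≤-resp₂ (minus y) (minus x) (neg-mono-≤ p)
      where
      minus : ∀ x → - x ≈ (- 1#) * x
      minus x = trans (-‿cong (sym (*-identityˡ x))) (-‿distribˡ-* 1# x)
    cancel : ∀ x y → (- 1#) * x + (x + y) ≈ y
    cancel x y = trans (+-congʳ (trans (sym (-‿distribˡ-* 1# x)) (-‿cong (*-identityˡ x))))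
      (solve 2 (λ x y → :- x :+ (x :+ y) := y) refl x y)
    reflect : ∀ x y → ((- 1#) * x ⊔ (- 1#) * y) + (x + y) ≈ x ⊔ y
    reflect x y with ≤-total x y
    ... | inj₁ p = trans (+-congʳ (trans (⊔-comm _ _) (x≤y⇒x⊔y≈y (-1*-antimono p))))
                     (trans (cancel x y) (sym (x≤y⇒x⊔y≈y p)))
    ... | inj₂ p = trans (+-cong (x≤y⇒x⊔y≈y (-1*-antimono p)) (+-comm x y))
                     (trans (cancel y x) (sym (trans (⊔-comm x y) (x≤y⇒x⊔y≈y p))))

  -- The complementary summand of △ K in Z is the union over t in K of -𝐞 t + ∑ F t,
  -- where F t contracts every edge of K at t to the vertex 𝐞 t.
  module _ (K : Subset n) (ne : Nonempty K) (clique : InducesClique G K) where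

    private
      Contracted : Fin n → Fin n × Fin n → Set
      Contracted t (u , v) = (u ∈ˢ K × v ∈ˢ K) × (u ≡ t ⊎ v ≡ t)

      contracted? : ∀ t e → Dec (Contracted t e)
      contracted? t (u , v) = (u ∈? K ×-dec v ∈? K) ×-dec (u Fin.≟ t ⊎-dec v Fin.≟ t)

      -- The decision is an explicit argument so that the lemmas below can split on it.
      contract : ∀ t e → Dec (Contracted t e) → Polytope {n}
      contract t e       (yes _) = singleton (𝐞 t)
      contract t (u , v) (no  _) = segment (𝐞 u) (𝐞 v)

      F : Fin n → Fin n × Fin n → Polytope {n}
      F t e = contract t e (contracted? t e)

      h-𝐞 : ∀ w t → h (singleton (𝐞 t)) w ≈ w t
      h-𝐞 w t = trans (h-singleton (𝐞 t) w) (⟨⟩-𝐞 w t)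

      contract≤maxEnd : ∀ w t e c → h (contract t e c) w ≤ maxEnd w e
      contract≤maxEnd w t (u , v) (yes (_ , inj₁ ≡.refl)) = ≤-respˡ-≈ (sym (h-𝐞 w t)) (x≤x⊔y (w t) (w v))
      contract≤maxEnd w t (u , v) (yes (_ , inj₂ ≡.refl)) = ≤-respˡ-≈ (sym (h-𝐞 w t)) (x≤y⊔x (w u) (w t))
      contract≤maxEnd w t (u , v) (no  _)                 = ≤-reflexive (h-segment-𝐞 u v w)

      contract-contracted : ∀ w t {e} c → Contracted t e → h (contract t e c) w ≈ w t
      contract-contracted w t (yes _) _ = h-𝐞 w t
      contract-contracted w t (no ¬c) c = contradiction c ¬c

      contract≈maxEnd : ∀ w t → (∀ {x} → x ∈ˢ K → w x ≤ w t) → ∀ e c → h (contract t e c) w ≈ maxEnd w e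
      contract≈maxEnd w t max (u , v) (yes ((_ , v∈) , inj₁ ≡.refl)) =
        trans (h-𝐞 w t) (sym (trans (⊔-comm (w t) (w v)) (x≤y⇒x⊔y≈y (max v∈))))
      contract≈maxEnd w t max (u , v) (yes ((u∈ , _) , inj₂ ≡.refl)) = trans (h-𝐞 w t) (sym (x≤y⇒x⊔y≈y (max u∈)))
      contract≈maxEnd w t max (u , v) (no  _)                        = h-segment-𝐞 u v w

      summand : Fin n → Polytope {n}
      summand t = singleton ((- 1#) *ₚ 𝐞 t) ⊕ ⨁ (F t) (edges G)

      h-summand : ∀ w t → h (summand t) w ≈ - w t + ∑ₗ (λ e → h (F t e) w) (edges G)
      h-summand w t = trans (h-⊕ _ _ w) (+-cong
        (trans (h-singleton _ w) (trans (⟨⟩-*ʳ (- 1#) w (𝐞 t))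
          (trans (*-congˡ (⟨⟩-𝐞 w t)) (trans (sym (-‿distribˡ-* 1# (w t))) (-‿cong (*-identityˡ (w t)))))))
        (h-⨁ (F t) (edges G) w))

      ts : List (Fin n)
      ts = filter (_∈? K) (allFin n)

      ts≢[] : ts ≢ []
      ts≢[] e with () ← ≡.subst (proj₁ ne ∈_) e (∈-filter⁺ (_∈? K) (∈-allFin (proj₁ ne)) (proj₂ ne))

      -- Contracting to a maximiser m of w on K costs nothing, since m wins every edge of K at m;
      -- its summand attains the value. For any other t in K, the edge between m and t, present as K
      -- is a clique, is contracted to t and loses `w m - w t`. This offsets the gain of subtracting
      -- `w t` in place of `w m`.
      h-complement : ∀ w → h (⋃ summand ts ts≢[]) w ≈ h Z w - h (△ K ne) w
      h-complement w = let m , m∈ , wm≈ = h-△-attained K ne w in complement m m∈ wm≈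
        where
        complement : ∀ m → m ∈ˢ K → w m ≈ h (△ K ne) w → h (⋃ summand ts ts≢[]) w ≈ h Z w - h (△ K ne) w
        complement m m∈ wm≈ = h-⋃-unique summand ts ts≢[] w upper
                ( m , ∈-filter⁺ (_∈? K) (∈-allFin m) m∈
                , trans (h-summand w m) (trans (+-comm _ _) (+-cong
                    (trans (∑ₗ-cong (edges G) λ {e} _ → contract≈maxEnd w m (λ x∈ → ≤-respʳ-≈ (sym wm≈) (w≤h-△ K ne w x∈)) e (contracted? m e))
                           (sym (h-Z w)))
                    (-‿cong wm≈))) )
          where
          M = h (△ K ne) w
          gap : ∀ t → t ∈ˢ K → (M - w t) + ∑ₗ (λ e → h (F t e) w) (edges G) ≤ ∑ₗ (maxEnd w) (edges G)
          gap t t∈ with m Fin.≟ t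
          ... | yes ≡.refl = ≤-respˡ-≈ (sym (trans (+-congʳ (trans (+-congʳ (sym wm≈)) (-‿inverseʳ _))) (+-identityˡ _)))
                               (∑ₗ-mono (edges G) λ {e} _ → contract≤maxEnd w t e (contracted? t e))
          ... | no  m≢t with Adj⇒edge (clique m∈ t∈ m≢t)
          ...   | inj₁ e∈ = ∑ₗ-gap (edges G) (λ {e} _ → contract≤maxEnd w t e (contracted? t e)) e∈
                    (≤-respˡ-≈ (sym (trans (+-congˡ (contract-contracted w t (contracted? t (m , t)) ((m∈ , t∈) , inj₂ ≡.refl)))
                      (trans (solve 2 (λ M x → (M :- x) :+ x := M) refl M (w t)) (sym wm≈)))) (x≤x⊔y _ _))
          ...   | inj₂ e∈ = ∑ₗ-gap (edges G) (λ {e} _ → contract≤maxEnd w t e (contracted? t e)) e∈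
                    (≤-respˡ-≈ (sym (trans (+-congˡ (contract-contracted w t (contracted? t (t , m)) ((t∈ , m∈) , inj₁ ≡.refl)))
                      (trans (solve 2 (λ M x → (M :- x) :+ x := M) refl M (w t)) (sym wm≈)))) (x≤y⊔x _ _))
          upper : ∀ {t} → t ∈ ts → h (summand t) w ≤ h Z w - M
          upper {t} t∈ = ≤-resp₂
            (trans (solve 3 (λ M x s → (:- M) :+ ((M :- x) :+ s) := :- x :+ s) refl M (w t) _) (sym (h-summand w t)))
            (trans (+-comm _ _) (+-congʳ (sym (h-Z w))))
            (+-monoʳ-≤ (- M) (gap t (proj₂ (∈-filter⁻ (_∈? K) {xs = allFin n} t∈))))

    DC-△ : DC Z (△ K ne)
    DC-△ = h⇒DC {△ K ne} (⋃ summand ts ts≢[]) 0≤1 λ w → trans (+-congˡ (h-complement w))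
      (trans (solve 2 (λ a z → a :+ (z :- a) := z) refl (h (△ K ne) w) (h Z w)) (sym (*-identityˡ _)))

  DC-cliqueFace : ∀ K → DC Z (cliqueFace G K)
  DC-cliqueFace K@record { set = S } = DC-△ S (nonemptyᴷ K) (cliqueᴷ K)

-- Fan-linear functions are combinations of the support functions of clique faces.

module Spanning (𝓡 : RealField) {n : ℕ} (G : SimpleGraph n) where
  open OrderedField 𝓡
  open Reals 𝓡 hiding (Point; module LinearAlgebra)
  open Support 𝓡 {n}
  open SimpleGraph G using (Adj; irrefl) renaming (sym to Adj-sym)
  open Cliques G
  open Interpolation 𝓡 G
  open Deformations 𝓡 G

  sameOrder-constˡ : ∀ w w′ {u v} → w u ≈ w v → SameOrder w w′ u v
  sameOrder-constˡ w w′ {u} {v} e =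
    Sum.map (λ p → ≤-reflexive e , p) (λ p → ≤-reflexive (sym e) , p) (≤-total (w′ u) (w′ v))

  sameOrder-constʳ : ∀ w w′ {u v} → w′ u ≈ w′ v → SameOrder w w′ u v
  sameOrder-constʳ w w′ {u} {v} e =
    Sum.map (λ p → p , ≤-reflexive e) (λ p → p , ≤-reflexive (sym e)) (≤-total (w u) (w v))

  sameOrder-≈ : ∀ w w′ {u v} → w u ≈ w′ u → w v ≈ w′ v → SameOrder w w′ u v
  sameOrder-≈ w w′ {u} {v} e e′ =
    Sum.map (λ p → p , ≤-resp₂ e e′ p) (λ p → p , ≤-resp₂ e′ e p) (≤-total (w u) (w v))

  -- Two free values let one modularity lemma serve both families: - 1_S, on which the faces are
  -- tested, and the directions of the equations.
  level : ℝ → ℝ → Subset n → Point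
  level a b S v = if lookup S v then a else b

  -- level 1# (- 1#) S is the normal vector of the facet inequality of S
  dir : Subset n → Point
  dir = level 1# (- 1#)

  module _ (a b : ℝ) where

    level-∈ : ∀ {S v} → v ∈ˢ S → level a b S v ≈ a
    level-∈ v∈ = reflexive (≡.cong (if_then a else b) ([]=⇒lookup v∈))

    level-∉ : ∀ {S v} → v ∉ˢ S → level a b S v ≈ b
    level-∉ {S} {v} v∉ = reflexive (≡.cong (if_then a else b) (Bool.¬-not λ p → v∉ (lookup⇒[]= v S p)))

    private
      level-cong : ∀ {S T x y} → lookup S x ≡ lookup T y → level a b S x ≈ level a b T y
      level-cong e = reflexive (≡.cong (if_then a else b) e)

      level-≡ : ∀ {S x s} → lookup S x ≡ s → level a b S x ≈ (if s then a else b)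
      level-≡ e = reflexive (≡.cong (if_then a else b) e)

    -- A Boolean condition sufficient for `SameOrder` that never compares a with b: one of the two
    -- vectors is constant on the pair, or they agree at both of its ends.
    Aligned : Subset n → Subset n → Fin n → Fin n → Set
    Aligned S T u v = (lookup S u ≡ lookup S v ⊎ lookup T u ≡ lookup T v) ⊎
                      (lookup S u ≡ lookup T u × lookup S v ≡ lookup T v)

    aligned⇒sameOrder : ∀ {S T u v} → Aligned S T u v → SameOrder (level a b S) (level a b T) u v
    aligned⇒sameOrder {S} {T} (inj₁ (inj₁ e)) = sameOrder-constˡ (level a b S) (level a b T) (level-cong {S} {S} e)
    aligned⇒sameOrder {S} {T} (inj₁ (inj₂ e)) = sameOrder-constʳ (level a b S) (level a b T) (level-cong {T} {T} e)
    aligned⇒sameOrder {S} {T} (inj₂ (e , e′)) = sameOrder-≈ (level a b S) (level a b T) (level-cong {S} {T} e) (level-cong {S} {T} e′)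

    -- If both sets separate u from v, the end lying in T also lies in S, so they separate the two
    -- in the same way.
    aligned-nested : ∀ S T → (∀ x → lookup T x ≡ true → lookup S x ≡ true) → ∀ u v → Aligned S T u v
    aligned-nested S T T⊆S u v = decide _ _ _ _ (T⊆S u) (T⊆S v)
      where
      decide : ∀ s t s′ t′ → (s′ ≡ true → s ≡ true) → (t′ ≡ true → t ≡ true) →
               (s ≡ t ⊎ s′ ≡ t′) ⊎ (s ≡ s′ × t ≡ t′)
      decide true  true  _     _     _ _ = inj₁ (inj₁ ≡.refl)
      decide false false _     _     _ _ = inj₁ (inj₁ ≡.refl)
      decide true  false true  false _ _ = inj₂ (≡.refl , ≡.refl)
      decide true  false false false _ _ = inj₁ (inj₂ ≡.refl)
      decide true  false _     true  _ q with () ← q ≡.refl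
      decide false true  false true  _ _ = inj₂ (≡.refl , ≡.refl)
      decide false true  false false _ _ = inj₁ (inj₂ ≡.refl)
      decide false true  true  _     p _ with () ← p ≡.refl

    module _ {S : Subset n} (e : NonEdgeIn G S) where
      open NonEdgeIn e

      private
        A = S ∖ u
        B = S ∖ v
        C = S ∖ u ∖ v

        Av : lookup A v ≡ true
        Av = ≡.trans (lookup-∖-≢ S (distinct ∘ ≡.sym)) ([]=⇒lookup v∈S)

        Bu : lookup B u ≡ true
        Bu = ≡.trans (lookup-∖-≢ S distinct) ([]=⇒lookup u∈S)

        Cu : lookup C u ≡ false
        Cu = ≡.trans (lookup-∖-≢ A distinct) (lookup-∖-≡ S u)

        data Position : Fin n → Set where
          at-u  : Position u
          at-v  : Position v
          other : ∀ {x} → x ≢ u → x ≢ v → Position x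

        position : ∀ x → Position x
        position x with x Fin.≟ u | x Fin.≟ v
        ... | yes ≡.refl | _          = at-u
        ... | no _       | yes ≡.refl = at-v
        ... | no x≢u     | no x≢v     = other x≢u x≢v

        aligned-other : ∀ {p q r s : Bool} → p ≢ q → r ≡ s → p ≡ r ⊎ q ≡ s
        aligned-other {true}  {true}          p≢q _      = contradiction ≡.refl p≢q
        aligned-other {false} {false}         p≢q _      = contradiction ≡.refl p≢q
        aligned-other {true}  {false} {true}  _   ≡.refl = inj₁ ≡.refl
        aligned-other {true}  {false} {false} _   ≡.refl = inj₂ ≡.refl
        aligned-other {false} {true}  {true}  _   ≡.refl = inj₂ ≡.refl
        aligned-other {false} {true}  {false} _   ≡.refl = inj₁ ≡.refl

        A≢B-at-u : lookup A u ≢ lookup B u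
        A≢B-at-u p with () ← ≡.trans (≡.sym (lookup-∖-≡ S u)) (≡.trans p Bu)

        A≢B-at-v : lookup A v ≢ lookup B v
        A≢B-at-v p with () ← ≡.trans (≡.sym Av) (≡.trans p (lookup-∖-≡ S v))

        A≡B : ∀ {x} → x ≢ u → x ≢ v → lookup A x ≡ lookup B x
        A≡B x≢u x≢v = ≡.trans (lookup-∖-≢ S x≢u) (≡.sym (lookup-∖-≢ S x≢v))

        aligned-AB : ∀ {x y} → Adj x y → Position x → Position y → Aligned A B x y
        aligned-AB adj at-u          at-u          = contradiction adj (irrefl ≡.refl)
        aligned-AB adj at-v          at-v          = contradiction adj (irrefl ≡.refl)
        aligned-AB adj at-u          at-v          = contradiction adj notAdj
        aligned-AB adj at-v          at-u          = contradiction (Adj-sym adj) notAdj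
        aligned-AB adj (other p q)   (other p′ q′) = inj₂ (A≡B p q , A≡B p′ q′)
        aligned-AB adj at-u          (other p q)   = inj₁ (aligned-other A≢B-at-u (A≡B p q))
        aligned-AB adj at-v          (other p q)   = inj₁ (aligned-other A≢B-at-v (A≡B p q))
        aligned-AB adj (other p q)   at-u          = inj₁ (Sum.map ≡.sym ≡.sym (aligned-other A≢B-at-u (A≡B p q)))
        aligned-AB adj (other p q)   at-v          = inj₁ (Sum.map ≡.sym ≡.sym (aligned-other A≢B-at-v (A≡B p q)))

        C⊆S : ∀ x → lookup C x ≡ true → lookup S x ≡ true
        C⊆S x p = []=⇒lookup (p∖x⊆p S u (p∖x⊆p A v (lookup⇒[]= x C p)))

        exchange : ∀ {x} → Position x → level a b A x + level a b B x ≈ level a b S x + level a b C x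
        exchange at-u = trans
          (+-cong (level-≡ {A} (lookup-∖-≡ S u)) (level-≡ {B} Bu))
          (trans (+-comm b a) (sym (+-cong (level-≡ {S} ([]=⇒lookup u∈S)) (level-≡ {C} Cu))))
        exchange at-v = trans
          (+-cong (level-≡ {A} Av) (level-≡ {B} (lookup-∖-≡ S v)))
          (sym (+-cong (level-≡ {S} ([]=⇒lookup v∈S)) (level-≡ {C} (lookup-∖-≡ A v))))
        exchange {x} (other x≢u x≢v) = +-cong
          (level-cong {A} {S} (lookup-∖-≢ S x≢u))
          (level-cong {B} {C} (≡.trans (≡.sym (A≡B x≢u x≢v)) (≡.sym (lookup-∖-≢ A x≢v))))

      -- The vectors of A and B have the same sum as those of S and C. The nested pair is compatible
      -- everywhere. A and B differ only at u and v, which no edge joins; on an edge with one end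
      -- there, one of A and B is constant.
      level-modular : ∀ {f} → FanLinear f → ModularAt e (λ S → f (level a b S))
      level-modular F = trans
        (sym (additive (level a b A) (level a b B) λ {x} {y} adj →
          aligned⇒sameOrder {A} {B} (aligned-AB adj (position x) (position y))))
        (trans (cong λ x → exchange (position x))
        (additive (level a b S) (level a b C) λ {x} {y} _ → aligned⇒sameOrder {S} {C} (aligned-nested S C C⊆S x y)))
        where open FanLinear F

  module _ {f : Point → ℝ} (F : FanLinear f) where
    open FanLinear F

    f0≈0 : f 0ₚ ≈ 0#
    f0≈0 = trans (cong λ v → sym (zeroˡ 0#)) (trans (homogeneous 0ₚ ≤-refl) (zeroˡ _))

    -- A constant vector ties the ends of every edge and so is compatible with any vector. This is
    -- the source of the equation h ∅ = - h V.
    constants-opposite : ∀ c → f (λ _ → c) + f (λ _ → - c) ≈ 0#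
    constants-opposite c = trans (sym (additive (λ _ → c) (λ _ → - c) λ {u} {v} _ →
        sameOrder-constˡ (λ _ → c) (λ _ → - c) {u} {v} refl))
      (trans (cong λ _ → -‿inverseʳ c) f0≈0)

    module _ (f≈0 : ∀ S → f (level (- 1#) 0# S) ≈ 0#) where

      -- With M the maximum of w on S, split off the multiple -M ≥ 0 of the
      -- level vector of S; the remainder vanishes at one more vertex.
      private
        nonpositive⇒f≈0 : ∀ m S w → ∣ S ∣ <ᴺ m → (∀ v → w v ≤ 0#) → (∀ {v} → v ∉ˢ S → w v ≈ 0#) → f w ≈ 0#
        nonpositive⇒f≈0 (suc m) S w (s≤s ∣S∣≤m) w≤0 w≈0 with nonempty? S
        ... | no empty = trans (cong λ v → w≈0 λ v∈ → empty (v , v∈)) f0≈0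
        ... | yes ne   = let u , u∈ , wu≈M = h-△-attained S ne w in split u u∈ wu≈M
          where
          M = h (△ S ne) w
          ℓ w″ : Point
          ℓ = (- M) *ₚ level (- 1#) 0# S
          w″ v = w v - ℓ v

          ℓ-∈ : ∀ {v} → v ∈ˢ S → ℓ v ≈ M
          ℓ-∈ v∈ = trans (*-congˡ (level-∈ (- 1#) 0# v∈)) (trans (sym (-‿distribˡ-* M (- 1#)))
            (trans (-‿cong (sym (-‿distribʳ-* M 1#))) (trans (-‿involutive _) (*-identityʳ M))))

          ℓ-∉ : ∀ {v} → v ∉ˢ S → ℓ v ≈ 0#
          ℓ-∉ v∉ = trans (*-congˡ (level-∉ (- 1#) 0# v∉)) (zeroʳ _)

          w″-∉ : ∀ {v} → v ∉ˢ S → w″ v ≈ 0#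
          w″-∉ v∉ = trans (+-cong (w≈0 v∉) (-‿cong (ℓ-∉ v∉))) (-‿inverseʳ 0#)

          w″≤0 : ∀ v → w″ v ≤ 0#
          w″≤0 v with v ∈? S
          ... | no  v∉ = ≤-reflexive (w″-∉ v∉)
          ... | yes v∈ = ≤-resp₂ (+-congˡ (-‿cong (sym (ℓ-∈ v∈)))) (-‿inverseʳ M)
                           (+-mono-≤ (w≤h-△ S ne w v∈) (≤-refl {x = - M}))

          split : ∀ u → u ∈ˢ S → w u ≈ M → f w ≈ 0#
          split u u∈ wu≈M = trans (cong λ v → solve 2 (λ x y → x := y :+ (x :- y)) refl (w v) (ℓ v))
            (trans (additive ℓ w″ λ {x} {y} _ → order x y)
            (trans (+-cong (trans (homogeneous (level (- 1#) 0# S) (neg-nonPos M≤0)) (trans (*-congˡ (f≈0 S)) (zeroʳ _)))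
                           (nonpositive⇒f≈0 m (S ∖ u) w″ (ℕ.<-≤-trans (x∈p⇒∣p-x∣<∣p∣ u∈) ∣S∣≤m) w″≤0 w″≈0))
                   (+-identityʳ 0#)))
            where
            M≤0 : M ≤ 0#
            M≤0 = ≤-respˡ-≈ wu≈M (w≤0 u)

            -- Both vectors are nonpositive on S and vanish off S, and ℓ is constant on either side.
            order : ∀ x y → SameOrder ℓ w″ x y
            order x y with x ∈? S | y ∈? S
            ... | yes x∈ | yes y∈ = sameOrder-constˡ ℓ w″ (trans (ℓ-∈ x∈) (sym (ℓ-∈ y∈)))
            ... | no  x∉ | no  y∉ = sameOrder-constˡ ℓ w″ (trans (ℓ-∉ x∉) (sym (ℓ-∉ y∉)))
            ... | yes x∈ | no  y∉ = inj₁ (≤-resp₂ (sym (ℓ-∈ x∈)) (sym (ℓ-∉ y∉)) M≤0 , ≤-respʳ-≈ (sym (w″-∉ y∉)) (w″≤0 x))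
            ... | no  x∉ | yes y∈ = inj₂ (≤-resp₂ (sym (ℓ-∈ y∈)) (sym (ℓ-∉ x∉)) M≤0 , ≤-respʳ-≈ (sym (w″-∉ x∉)) (w″≤0 y))

            w″≈0 : ∀ {v} → v ∉ˢ S ∖ u → w″ v ≈ 0#
            w″≈0 {v} v∉ with v Fin.≟ u | v ∈? S
            ... | yes ≡.refl | _      = trans (+-cong wu≈M (-‿cong (ℓ-∈ u∈))) (-‿inverseʳ M)
            ... | no v≢u     | yes v∈ = contradiction (x∈p∧x≢y⇒x∈p-y v∈ v≢u) v∉
            ... | no _       | no v∉S = w″-∉ v∉S

      levels-determine : ∀ w → f w ≈ 0#
      levels-determine w = trans
        (cong λ v → trans (solve 2 (λ x M → x := M :+ (x :- M)) refl (w v) M) (+-congʳ (sym (*-identityʳ M))))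
        (trans (additive (M *ₚ 𝟏) w″ λ {x} {y} _ → sameOrder-constˡ (M *ₚ 𝟏) w″ {x} {y} refl)
        (trans (+-cong (trans (homogeneous 𝟏 (∑-nonNeg λ v → x≤y⊔x (w v) 0#)) (trans (*-congˡ f𝟏≈0) (zeroʳ M)))
                       (nonpositive⇒f≈0 (suc n) ⊤ w″ (s≤s (∣p∣≤n ⊤)) w″≤0 λ v∉ → contradiction ∈⊤ v∉))
               (+-identityʳ 0#)))
        where
        -- A sum of positive parts instead of a maximum: it bounds w, is nonnegative as homogeneity
        -- requires, and exists also for empty V.
        M = sum (λ v → w v ⊔ 0#)
        𝟏 w″ : Point
        𝟏 _ = 1#
        w″ v = w v - M
        f𝟏≈0 : f 𝟏 ≈ 0#
        f𝟏≈0 = trans (sym (+-identityʳ _)) (trans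
          (+-congˡ (sym (trans (cong λ v → sym (level-∈ (- 1#) 0# (∈⊤ {x = v}))) (f≈0 ⊤))))
          (constants-opposite 1#))
        w″≤0 : ∀ v → w″ v ≤ 0#
        w″≤0 v = ≤-respʳ-≈ (-‿inverseʳ M) (+-mono-≤
          (≤-trans (x≤x⊔y (w v) 0#) (term≤∑ (λ v → x≤y⊔x (w v) 0#) v)) (≤-refl {x = - M}))

  ⊈⇒∃∉ : ∀ {S T : Subset n} → ¬ (S ⊆ T) → ∃ λ x → x ∈ˢ S × x ∉ˢ T
  ⊈⇒∃∉ {S} {T} S⊈T with Fin.any? (λ x → x ∈? S ×-dec ¬? (x ∈? T))
  ... | yes p = p
  ... | no ¬p = contradiction (λ {x} → S⊆T {x}) S⊈T
    where
    S⊆T : S ⊆ T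
    S⊆T {x} x∈S with x ∈? T
    ... | yes x∈T = x∈T
    ... | no  x∉T = contradiction (x , x∈S , x∉T) ¬p

  -- As `a ≤ b` puts the smaller value on S, a single vertex of the face outside S already raises
  -- the maximum to b.
  h-cliqueFace-level : ∀ L {a b} S → a ≤ b →
    h (cliqueFace G L) (level a b S) ≈ b + (a - b) * 𝟙[ NonemptyClique.set L ⊆ S ]
  h-cliqueFace-level L@record { set = T ; nonempty = ne } {a} {b} S a≤b with T ⊆? S
  ... | yes T⊆S = trans (h-△-unique T ne (level a b S)
          (λ u∈ → ≤-reflexive (level-∈ a b (T⊆S u∈)))
          (let u , u∈ = nonemptyᴷ L in u , u∈ , level-∈ a b (T⊆S u∈)))
        (sym (trans (+-congˡ (trans (*-congˡ (𝟙[⊆]≈1 T⊆S)) (*-identityʳ _)))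
          (solve 2 (λ a b → b :+ (a :- b) := a) refl a b)))
  ... | no  T⊈S = trans (h-△-unique T ne (level a b S) below
          (let u , u∈ , u∉ = ⊈⇒∃∉ T⊈S in u , u∈ , level-∉ a b u∉))
        (sym (trans (+-congˡ (trans (*-congˡ (𝟙[⊆]≈0 T⊈S)) (zeroʳ _))) (+-identityʳ b)))
    where
    below : ∀ {u} → u ∈ˢ T → level a b S u ≤ b
    below {u} _ with u ∈? S
    ... | yes u∈ = ≤-respˡ-≈ (sym (level-∈ a b u∈)) a≤b
    ... | no  u∉ = ≤-reflexive (level-∉ a b u∉)

  h-cliqueFace-negative : ∀ L S → h (cliqueFace G L) (level (- 1#) 0# S) ≈ - 𝟙[ NonemptyClique.set L ⊆ S ]
  h-cliqueFace-negative L S = trans (h-cliqueFace-level L S (neg-nonNeg 0≤1))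
    (trans (+-identityˡ _) (trans (*-congʳ (trans (+-congˡ -0#≈0#) (+-identityʳ _)))
    (trans (sym (-‿distribˡ-* 1# _)) (-‿cong (*-identityˡ _)))))

  -- The difference of f and the interpolating combination is again fan-linear and vanishes at all -
  -- 1_S, hence everywhere. The sign in g matches the negative values of the faces there.
  FanLinear⇒∑cliqueFaces : ∀ {f} → FanLinear f →
    Σ (Vector ℝ dim) λ y → ∀ w → f w ≈ sum (λ i → y i * h (cliqueFace G (φ i)) w)
  FanLinear⇒∑cliqueFaces {f} F = y , λ w →
      trans (solve 2 (λ a s → a := (a :- s) :+ s) refl (f w) (Y w))
            (trans (+-congʳ (levels-determine f-Y agree w)) (+-identityˡ _))
    where
    g : Subset n → ℝ
    g S = - f (level (- 1#) 0# S)
    interpolated = interpolation nonEdge g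
      (trans (-‿cong (trans (FanLinear.cong F λ v → level-∉ (- 1#) 0# (∉⊥ {x = v})) (f0≈0 F))) -0#≈0#)
      (λ S → trans (-‿+-comm _ _) (trans (-‿cong (level-modular (- 1#) 0# (nonEdge S) F)) (sym (-‿+-comm _ _))))
    y = proj₁ interpolated
    Y : Point → ℝ
    Y w = sum (λ i → y i * h (cliqueFace G (φ i)) w)
    f-Y : FanLinear (λ w → f w - Y w)
    f-Y = FanLinear-- F (FanLinear-∑ y λ i → DC⇒FanLinear {cliqueFace G (φ i)} (DC-cliqueFace (φ i)))
    agree : ∀ S → f (level (- 1#) 0# S) - Y (level (- 1#) 0# S) ≈ 0#
    agree S = trans (+-congʳ (trans (sym (-‿involutive _)) (-‿cong (proj₂ interpolated S))))
      (trans (+-congˡ (-‿cong (trans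
        (∑-cong λ i → trans (*-congˡ (h-cliqueFace-negative (φ i) S)) (sym (-‿distribʳ-* (y i) 𝟙[ K i ⊆ S ])))
        (∑-neg (λ i → y i * 𝟙[ K i ⊆ S ])))))
      (-‿inverseʳ _))

-- The basis of virtual deformations, and the system of equations.

module VirtualDeformations (𝓡 : RealField) {n : ℕ} (G : SimpleGraph n) where
  open OrderedField 𝓡
  open Reals 𝓡 hiding (Point; module LinearAlgebra)
  open Support 𝓡 {n}
  open Triangular 𝓡
  open Cliques G
  open Interpolation 𝓡 G
  open Deformations 𝓡 G
  open Spanning 𝓡 G
  open VirtualPolytope

  face : NonemptyClique G → VirtualPolytope
  face L = ι (cliqueFace G L)

  ι∈VD : ∀ {P} → DC Z P → VD Z (ι P)
  ι∈VD {P} P∈ = 1 , (λ _ → 1#) , (λ _ → ι P) ,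
    (λ _ → P , P∈ , hᵛ≈⇒≈ⱽ {ι P} {ι P} λ _ → refl) ,
    hᵛ≈⇒≈ⱽ {ι P} {linearCombination (λ (_ : Fin 1) → 1#) (λ _ → ι P)} λ w →
      sym (trans (hᵛ-linearCombination (λ (_ : Fin 1) → 1#) (λ _ → ι P) w)
                 (trans (+-identityʳ _) (*-identityˡ _)))

  DC-·ⱽ : ∀ r {x} → DC Z (plus x) → DC Z (minus x) → DC Z (plus (r ·ⱽ x)) × DC Z (minus (r ·ⱽ x))
  DC-·ⱽ r {x} p q with 0# ≤? r
  ... | yes r≥0 = DC-⊙ {P = plus x} r≥0 p , DC-⊙ {P = minus x} r≥0 q
  ... | no  r≱0 = DC-⊙ {P = minus x} -r≥0 q , DC-⊙ {P = plus x} -r≥0 p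
    where -r≥0 = neg-nonPos (≰⇒≥ r≱0)

  DC-linearCombination : ∀ {k} (c : Vector ℝ k) (P : Fin k → Polytope) → (∀ i → DC Z (P i)) →
    let x = linearCombination c (ι ∘ P) in DC Z (plus x) × DC Z (minus x)
  DC-linearCombination {zero}  c P P∈ = DC-𝟎 , DC-𝟎
  DC-linearCombination {suc k} c P P∈ =
    let p , q = DC-·ⱽ (c zero) {ι (P zero)} (P∈ zero) DC-𝟎
        p′ , q′ = DC-linearCombination (c ∘ suc) (P ∘ suc) (P∈ ∘ suc)
        y = c zero ·ⱽ ι (P zero)
        z = linearCombination (c ∘ suc) (ι ∘ P ∘ suc)
    in DC-⊕ {plus y} {plus z} p p′ , DC-⊕ {minus y} {minus z} q q′

  -- Terms with nonnegative coefficients are collected in the plus part, the others in the minus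
  -- part; `IsD` asks for such a difference.
  VD⇒difference : ∀ {x} → VD Z x → ∃₂ λ P Q → DC Z P × DC Z Q × x ≈ⱽ (P ⊖ Q)
  VD⇒difference {x} (k , c , a , a∈ , x≈) =
    plus y , minus y , proj₁ PQ∈ , proj₂ PQ∈ , hᵛ≈⇒≈ⱽ {x} {y} λ w →
      trans (≈ⱽ⇒hᵛ≈ {x} {linearCombination c a} x≈ w)
      (trans (hᵛ-linearCombination c a w)
      (trans (∑-cong λ i → *-congˡ (≈ⱽ⇒hᵛ≈ {a i} {ι (P i)} (proj₂ (proj₂ (a∈ i))) w))
             (sym (hᵛ-linearCombination c (ι ∘ P) w))))
    where
    P : Fin k → Polytope
    P i = proj₁ (a∈ i)
    y = linearCombination c (ι ∘ P)
    PQ∈ = DC-linearCombination c P (λ i → proj₁ (proj₂ (a∈ i)))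

  difference⇒VD : ∀ {x P Q} → DC Z P → DC Z Q → x ≈ⱽ (P ⊖ Q) → VD Z x
  difference⇒VD {x} {P} {Q} P∈ Q∈ x≈ = 2 , c , a , a∈ , hᵛ≈⇒≈ⱽ {x} {linearCombination c a} λ w →
    trans (≈ⱽ⇒hᵛ≈ {x} {P ⊖ Q} x≈ w) (sym (trans (hᵛ-linearCombination c a w)
      (+-cong (trans (*-identityˡ _) (hᵛ-ι P w))
              (trans (+-identityʳ _) (trans (*-congˡ (hᵛ-ι Q w))
                (trans (sym (-‿distribˡ-* 1# _)) (-‿cong (*-identityˡ _))))))))
    where
    c : Vector ℝ 2
    c zero    = 1#
    c (suc _) = - 1#
    a : Vector VirtualPolytope 2
    a zero    = ι P
    a (suc _) = ι Q
    a∈ : ∀ i → ∃ λ P → DC Z P × a i ≈ⱽ ι P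
    a∈ zero    = P , P∈ , hᵛ≈⇒≈ⱽ {ι P} {ι P} λ _ → refl
    a∈ (suc _) = Q , Q∈ , hᵛ≈⇒≈ⱽ {ι Q} {ι Q} λ _ → refl

  h-difference-FanLinear : ∀ {P Q} → DC Z P → DC Z Q → FanLinear (λ w → h P w - h Q w)
  h-difference-FanLinear {P} {Q} P∈ Q∈ = FanLinear-- (DC⇒FanLinear {P} P∈) (DC⇒FanLinear {Q} Q∈)

  VD⇒∑faces : ∀ {x} → VD Z x → Σ (Vector ℝ dim) λ y → x ≈ⱽ linearCombination y (face ∘ φ)
  VD⇒∑faces {x} x∈ =
    let P , Q , P∈ , Q∈ , x≈ = VD⇒difference {x} x∈
        y , eq = FanLinear⇒∑cliqueFaces (h-difference-FanLinear {P} {Q} P∈ Q∈)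
    in y , hᵛ≈⇒≈ⱽ {x} {linearCombination y (face ∘ φ)} λ w →
      trans (≈ⱽ⇒hᵛ≈ {x} {P ⊖ Q} x≈ w) (trans (eq w) (sym
        (trans (hᵛ-linearCombination y (face ∘ φ) w) (∑-cong λ i → *-congˡ (hᵛ-ι (cliqueFace G (φ i)) w)))))

  -- Evaluated at the level vectors of the cliques themselves, the support
  -- functions of the faces form a unitriangular matrix.
  faces-independent : LinearlyIndependent face
  faces-independent k ψ ψ-inj c e = triangular-injective (λ i → ∣ set i ∣) (λ i j → 𝟙[ set j ⊆ set i ])
    (λ i → 𝟙[⊆]≈1 (λ x∈ → x∈)) (𝟙[φ⊆φ]-vanishes ψ ψ-inj) c λ i → trans
      (trans (∑-cong λ j → trans (*-comm _ _) (trans (sym (-‿involutive _)) (-‿cong (trans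
          (-‿distribʳ-* (c j) _)
          (*-congˡ (sym (trans (hᵛ-ι (cliqueFace G (ψ j)) (w i)) (h-cliqueFace-negative (ψ j) (set i)))))))))
        (∑-neg (λ j → c j * hᵛ (face (ψ j)) (w i))))
      (trans (-‿cong (trans (sym (hᵛ-linearCombination c (face ∘ ψ) (w i)))
        (trans (≈ⱽ⇒hᵛ≈ {linearCombination c (face ∘ ψ)} {𝟎 ⊖ 𝟎} e (w i)) (-‿inverseʳ _)))) -0#≈0#)
    where
    set : Fin k → Subset n
    set i = NonemptyClique.set (ψ i)
    w : Fin k → Point
    w i = level (- 1#) 0# (set i)

  faces-basis : IsBasis (VD Z) face
  faces-basis = (λ L → ι∈VD {cliqueFace G L} (DC-cliqueFace L)) , faces-independent , λ x x∈ →
    let y , x≈ = VD⇒∑faces {x} x∈ in dim , y , face ∘ φ , (λ i → φ i , ≡.refl) , x≈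

  dimension : HasDimension (VD Z) dim
  dimension = face ∘ φ ,
    (λ i → ι∈VD {cliqueFace G (φ i)} (DC-cliqueFace (φ i))) ,
    (λ k ψ ψ-inj → faces-independent k (φ ∘ ψ) (ψ-inj ∘ φ-injective)) ,
    λ x x∈ → let y , x≈ = VD⇒∑faces {x} x∈ in dim , y , face ∘ φ , (λ i → i , ≡.refl) , x≈

  direction≈⟨dir⟩ : ∀ S x → direction S x ≈ ⟨ dir S , x ⟩
  direction≈⟨dir⟩ S x = trans (+-congˡ (sym (∑-neg (λ v → if lookup (∁ S) v then x v else 0#)))) (trans
    (sym (∑-distrib-+ (λ v → if lookup S v then x v else 0#) (λ v → - (if lookup (∁ S) v then x v else 0#))))
    (∑-cong λ v → trans
      (+-congˡ (-‿cong (reflexive (≡.cong (if_then x v else 0#) (lookup-map v not S)))))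
      (signed (lookup S v) (x v))))
    where
    signed : ∀ s y → (if s then y else 0#) - (if not s then y else 0#) ≈ (if s then 1# else - 1#) * y
    signed true  y = trans (+-congˡ -0#≈0#) (trans (+-identityʳ y) (sym (*-identityˡ y)))
    signed false y = trans (+-identityˡ _) (trans (-‿cong (sym (*-identityˡ y))) (-‿distribˡ-* 1# y))

  h-supportVector : ∀ P → IsSupportVector P (λ S → h P (dir S))
  h-supportVector P S =
    (λ x x∈ → ≤-respˡ-≈ (sym (direction≈⟨dir⟩ S x)) (⟦⟧⇒⟨⟩≤h P (dir S) x∈)) ,
    (let p , p∈ , e = h-attained P (dir S) in p , points⊆⟦⟧ P p∈ , trans (direction≈⟨dir⟩ S p) e)

  module System (choice : (S : NonClique G) → NonEdgeIn G (NonClique.set S)) where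
    open Equations G choice

    FanLinear⇒Satisfies : ∀ {f} → FanLinear f → Satisfies (f ∘ dir)
    -- The directions of V and ∅ are the constants 1 and - 1.
    FanLinear⇒Satisfies {f} F nothing = trans
      (solve 2 (λ a b → a := (b :+ a) :- b) refl (f (dir ⊥)) (f (dir ⊤)))
      (trans (+-congʳ (trans (+-cong
        (FanLinear.cong F λ v → level-∈ 1# (- 1#) (∈⊤ {x = v}))
        (FanLinear.cong F λ v → level-∉ 1# (- 1#) (∉⊥ {x = v})))
        (constants-opposite F 1#))) (+-identityˡ _))
    FanLinear⇒Satisfies F (just S) = level-modular 1# (- 1#) (choice S) F

    VD⇒D : ∀ x → VD Z x → ∃ λ g → Satisfies g × IsD Z g x
    VD⇒D x x∈ =
      let P , Q , P∈ , Q∈ , x≈ = VD⇒difference {x} x∈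
      in (λ S → h P (dir S) - h Q (dir S)) , FanLinear⇒Satisfies (h-difference-FanLinear {P} {Q} P∈ Q∈) ,
         P , Q , (λ S → h P (dir S)) , (λ S → h Q (dir S)) , P∈ , Q∈ ,
         h-supportVector P , h-supportVector Q , (λ _ → refl) , x≈

    D⇒VD : ∀ x → (∃ λ g → Satisfies g × IsD Z g x) → VD Z x
    D⇒VD x (_ , _ , P , Q , _ , _ , P∈ , Q∈ , _ , _ , _ , x≈) = difference⇒VD {x} {P} {Q} P∈ Q∈ x≈

    -- The values on S of a solution g, shifted and halved, are interpolated
    -- by the indicators 1_{K ⊆ S}, and these are the values at the indicator
    -- vector of S of w ↦ min_K w, the negated support function of - △ K.
    Satisfies⇒D : ∀ g → Satisfies g → ∃ λ x → IsD Z g x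
    Satisfies⇒D g sat = x , plus x , minus x , (λ S → h (plus x) (dir S)) , (λ S → h (minus x) (dir S)) ,
      proj₁ x∈ , proj₂ x∈ , h-supportVector (plus x) , h-supportVector (minus x) ,
      (λ S → sym (hᵛx S)) , hᵛ≈⇒≈ⱽ {x} {x} λ _ → refl
      where
      η = proj₁ half
      k : Subset n → ℝ
      -- The virtual polytope x below takes the value 2 k(S) - k(V) in direction S. With k(∅) = 0,
      -- equality with g forces k(V) = - g(∅), and so this k.
      k S = η * (g S - g ⊥)
      k-modular : ∀ S → ModularAt (choice S) k
      k-modular S = trans (collect (g (T ∖ u)) (g (T ∖ v))) (trans (*-congˡ (+-congʳ (sat (just S))))
                          (sym (collect (g T) (g (T ∖ u ∖ v)))))
        where
        open NonEdgeIn (choice S)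
        T = NonClique.set S
        collect : ∀ a b → η * (a - g ⊥) + η * (b - g ⊥) ≈ η * ((a + b) - (g ⊥ + g ⊥))
        collect a b = solve 4 (λ η a b o → η :* (a :- o) :+ η :* (b :- o) := η :* ((a :+ b) :- (o :+ o))) refl η a b (g ⊥)
      interpolated = interpolation choice k
        (trans (*-congˡ (-‿inverseʳ _)) (zeroʳ _))
        k-modular
      y = proj₁ interpolated
      P : Fin dim → Polytope
      P i = (- 1#) ⊙ cliqueFace G (φ i)
      x : VirtualPolytope
      x = linearCombination (λ i → - y i) (ι ∘ P)
      x∈ = DC-linearCombination (λ i → - y i) P λ i → DC-reflect {cliqueFace G (φ i)} (DC-cliqueFace (φ i))

      -dir : ∀ S v → ((- 1#) *ₚ dir S) v ≈ level (- 1#) 1# S v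
      -dir S v with lookup S v
      ... | true  = *-identityʳ _
      ... | false = trans (sym (-‿distribˡ-* 1# _)) (trans (-‿cong (*-identityˡ _)) (-‿involutive 1#))

      h-P : ∀ i S → h (P i) (dir S) ≈ 1# + ((- 1#) - 1#) * 𝟙[ K i ⊆ S ]
      h-P i S = trans (h-⊙ (- 1#) (cliqueFace G (φ i)) (dir S))
        (trans (h-cong (cliqueFace G (φ i)) (-dir S))
               (h-cliqueFace-level (φ i) S (≤-trans (neg-nonNeg 0≤1) 0≤1)))

      -- The constant `- y i` is written through the indicator at V, so that summation turns it into
      -- `- k ⊤`.
      term : ∀ i S → (- y i) * hᵛ (ι (P i)) (dir S) ≈
                     (y i * 𝟙[ K i ⊆ S ] + y i * 𝟙[ K i ⊆ S ]) + - (y i * 𝟙[ K i ⊆ ⊤ ])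
      term i S = trans (*-congˡ (trans (hᵛ-ι (P i) (dir S)) (h-P i S))) (trans
        (expand (y i) 𝟙[ K i ⊆ S ])
        (+-congˡ (-‿cong (sym (trans (*-congˡ (𝟙[⊆]≈1 (⊆-max (K i)))) (*-identityʳ _))))))
        where
        expand : ∀ y t → (- y) * (1# + ((- 1#) - 1#) * t) ≈ (y * t + y * t) + - y
        expand y t = trans
          (solve 3 (λ y t o → (:- y) :* (o :+ ((:- o) :- o) :* t) := o :* ((y :* t :+ y :* t) :+ (:- y))) refl y t 1#)
          (*-identityˡ _)

      hᵛx : ∀ S → h (plus x) (dir S) - h (minus x) (dir S) ≈ g S
      hᵛx S = trans (hᵛ-linearCombination (λ i → - y i) (ι ∘ P) (dir S)) (trans
        (∑-cong λ i → term i S) (trans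
        (∑-distrib-+ (λ i → s i + s i) (λ i → - (y i * 𝟙[ K i ⊆ ⊤ ]))) (trans
        (+-cong (∑-distrib-+ s s) (∑-neg (λ i → y i * 𝟙[ K i ⊆ ⊤ ]))) (trans
        (+-cong (sym (+-cong (proj₂ interpolated S) (proj₂ interpolated S))) (-‿cong (sym (proj₂ interpolated ⊤))))
        double))))
        where
        s : Fin dim → ℝ
        s i = y i * 𝟙[ K i ⊆ S ]
        double : (k S + k S) - k ⊤ ≈ g S
        double = trans
          (+-congˡ (-‿cong (*-congˡ (+-congʳ (trans (sym (-‿involutive _)) (-‿cong (sym (sat nothing))))))))
          (trans (solve 3 (λ η a o → (η :* (a :- o) :+ η :* (a :- o)) :- η :* ((:- o) :- o) := (η :+ η) :* a)
                   refl η (g S) (g ⊥))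
                 (trans (*-congʳ (proj₂ half)) (*-identityˡ _)))

    -- The equation of a non-clique is tested on minus the point mass at it,
    -- and h ∅ = - h V on a constant vector, which satisfies all the others.
    private
      mass : Subset n → Subset n → ℝ
      mass S T = if does (S ≟ˢ T) then - 1# else 0#

      mass-≡ : ∀ S → mass S S ≈ - 1#
      mass-≡ S = reflexive (≡.cong (if_then - 1# else 0#) (dec-true (S ≟ˢ S) ≡.refl))

      mass-≢ : ∀ S T → S ≢ T → mass S T ≈ 0#
      mass-≢ S T S≢T = reflexive (≡.cong (if_then - 1# else 0#) (dec-false (S ≟ˢ T) S≢T))

      test : Index → Subset n → ℝ
      -- One half gives the form h ∅ + h V the value 1.
      test nothing  _ = proj₁ half
      test (just S)   = mass (NonClique.set S)

      -- Larger sets rank lower, as the mass at S is invisible to the equation of any other set of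
      -- at most its size. The equation h ∅ = - h V ranks lowest: its test vector solves all the
      -- others, while it does see the mass at V.
      rank : Index → ℕ
      rank nothing  = 0
      rank (just S) = suc (n ∸ ∣ NonClique.set S ∣)

      NonClique-≡ : ∀ {S T : NonClique G} → NonClique.set S ≡ NonClique.set T → S ≡ T
      NonClique-≡ ≡.refl = ≡.refl

      size≢ : ∀ {S T : Subset n} → ∣ T ∣ <ᴺ ∣ S ∣ → S ≢ T
      size≢ p ≡.refl = ℕ.<-irrefl ≡.refl p

      form≈ : ∀ S (t : Subset n → ℝ) {a} → (∀ {T} → ∣ T ∣ <ᴺ ∣ NonClique.set S ∣ → t T ≈ 0#) →
              t (NonClique.set S) ≈ a → form (just S) t ≈ - a
      form≈ S t {a} small e = trans
        (+-cong (trans (+-cong (small (∣S∖u∣<∣S∣ E)) (small (∣S∖v∣<∣S∣ E))) (+-identityʳ 0#))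
                (-‿cong (trans (+-cong e (small (∣S∖u∖v∣<∣S∣ E))) (+-identityʳ a))))
        (+-identityˡ _)
        where E = choice S

      form-test-diagonal : ∀ i → form i (test i) ≈ 1#
      form-test-diagonal nothing  = trans (+-congˡ (-‿involutive _)) (proj₂ half)
      form-test-diagonal (just S) = trans
        (form≈ S (mass (NonClique.set S)) (λ {T} p → mass-≢ (NonClique.set S) T (size≢ p)) (mass-≡ (NonClique.set S)))
        (-‿involutive 1#)

      form-test-vanishes : ∀ i j → j ≢ i → rank i ≤ᴺ rank j → form j (test i) ≈ 0#
      form-test-vanishes nothing  nothing  j≢i _ = contradiction ≡.refl j≢i
      form-test-vanishes nothing  (just S) _   _ = -‿inverseʳ _
      form-test-vanishes (just S) (just T) T≢S (s≤s r) = trans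
        (form≈ T (mass (NonClique.set S))
          (λ {U} p → mass-≢ (NonClique.set S) U (size≢ (ℕ.<-≤-trans p ∣T∣≤∣S∣)))
          (mass-≢ (NonClique.set S) (NonClique.set T) λ e → T≢S (≡.cong just (NonClique-≡ (≡.sym e)))))
        -0#≈0#
        where
        ∣T∣≤∣S∣ : ∣ NonClique.set T ∣ ≤ᴺ ∣ NonClique.set S ∣
        ∣T∣≤∣S∣ = ℕ.≮⇒≥ λ p → ℕ.<⇒≱ (ℕ.∸-monoʳ-< p (∣p∣≤n (NonClique.set T))) r

    equations-independent : EquationsIndependent
    equations-independent k ψ ψ-inj c e = triangular-injective (rank ∘ ψ) (λ i j → form (ψ j) (test (ψ i)))
      (λ i → form-test-diagonal (ψ i))
      (λ i j j≢i r → form-test-vanishes (ψ i) (ψ j) (j≢i ∘ ψ-inj) r)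
      c λ i → trans (∑-cong λ j → *-comm _ (c j)) (trans (sym (evaluate c (form ∘ ψ) (test (ψ i)))) (e (test (ψ i))))
      where
      evaluate : ∀ {k} (c : Vector ℝ k) (f : Fin k → (Subset n → ℝ) → ℝ) t →
                 Reals.LinearAlgebra.linearCombination 𝓡 (functionSpace (Subset n → ℝ)) c f t ≈ sum (λ i → c i * f i t)
      evaluate {zero}  c f t = refl
      evaluate {suc k} c f t = +-congˡ (evaluate (c ∘ suc) (f ∘ suc) t)

theorem2p5 :
    (𝓡 : RealField) (n : ℕ) (G : SimpleGraph n) →
    let open Reals 𝓡
        open LinearAlgebra (virtualPolytopes {n})
        Z = zonotope G
    in
    (∃ λ d → (Fin d ↔ NonemptyClique G) × HasDimension (VD Z) d)
    × IsBasis (VD Z) (λ K → ι (cliqueFace G K))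
    × ((choice : (S : NonClique G) → NonEdgeIn G (NonClique.set S)) →
       let open Equations G choice in
       (∀ x → VD Z x ⇔ (∃ λ h → Satisfies h × IsD Z h x))
       × (∀ h → Satisfies h → ∃ λ x → IsD Z h x)
       × EquationsIndependent)
theorem2p5 𝓡 n G =
  (dim , proj₂ (Cliques.cliques G) , dimension) ,
  faces-basis ,
  λ choice → (λ x → mk⇔ (System.VD⇒D choice x) (System.D⇒VD choice x)) ,
             System.Satisfies⇒D choice , System.equations-independent choice
  where
  open Interpolation 𝓡 G using (dim)
  open VirtualDeformations 𝓡 G
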